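{- Consider a uniformly random priority queue (binomial heap) on $n$ distinct keys, and let $X_r$ be the set of the $r$ largest of these keys, $1\le r\le n$. Perform $r$ successive deletions of the maximum. Then the expected total number of comparisons in which both compared keys belong to $X_r$, caused by searching for the maximum element of the priority queue in these $r$ deletions, is at most $2\ln(2)\,r\log(r)$.
   Context: $\log$ is to base $2$. Binomial heaps. A heap of size $1$ is a single node. A heap of size $2^{k}$, $k>0$, is the join of two heaps of size $2^{k-1}$: the smaller root becomes a child of the larger root. Thus the root of a heap of size $2^k$ has $k$ children, which are roots of heaps of sizes $2^0,\dots,2^{k-1}$. A priority queue (binomial heap) on $n$ keys is a list (the Root list) of such heaps ordered by size, containing exactly one heap of size $2^s$ for each $2^s$ in the binary expansion of $n$. It is uniformly random if every configuration of the keys obeying the heap order is equally likely. Two Root lists are merged as in binary addition: proceeding by increasing size, two heaps of equal size are joined into a carry of twice the size; if two heaps and a carry of the same size are present, the carry is output and the two heaps are joined into the new carry. Deletion of the maximum: find the maximum by scanning the roots in the Root list, comparing each with the current maximum (this is the search whose comparisons are counted); delete the maximal root; merge the list of the heaps rooted at its children with the remaining Root list (comparisons made in this merging are not counted here). -}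

module Defs where

open import Data.Bool.Base using (if_then_else_)
open import Data.Digit using (Expansion; toDigits)
open import Data.Fin.Base using (zero; suc)
open import Data.Integer.Base as ℤ using (+_)
open import Data.List.Base
  using (List; []; _∷_; _++_; [_]; concatMap; filter; length; map)
import Data.List.Membership.DecPropositional as DecMembership
open import Data.Nat.Base as ℕ using (ℕ; zero; suc)
open import Data.Nat.ListAction using (sum)
import Data.Nat.Properties as ℕ
open import Data.Product.Base using (∃-syntax; _×_; _,_; proj₁; proj₂; map₁; map₂)
open import Data.Rational.Base as ℚ using (ℚ; 0ℚ; 1ℚ; ↥_; ↧ₙ_)
open import Function.Base using (flip; _∘_)
open import Level using (Level; _⊔_)
open import Relation.Binary.Core using (Rel)
open import Relation.Binary.PropositionalEquality.Core using (_≡_)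
open import Relation.Binary.Structures using (IsStrictTotalOrder)
open import Relation.Nullary.Decidable
  using (Dec; yes; no; does; map′; _×-dec_)

private
  variable
    a ℓ : Level
    k s : ℕ

------------------------------------------------------------------------
-- Non-negative real numbers

-- A real x ≥ 0 is given by its open upper cut { q ∈ ℚ ∣ x < q }.
-- All members of such a cut are positive, which is what makes
-- the formula for products below correct.

ℝ≥0 : Set₁
ℝ≥0 = ℚ → Set

fromℕℚ : ℕ → ℚ
fromℕℚ n = + n ℚ./ 1

fromℕ : ℕ → ℝ≥0
fromℕ n q = fromℕℚ n ℚ.< q

infixl 7 _·_

_·_ : ℝ≥0 → ℝ≥0 → ℝ≥0
(x · y) q = ∃[ b ] ∃[ c ] x b × y c × q ≡ b ℚ.* c

infix 4 _≤ℝ_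

_≤ℝ_ : ℚ → ℝ≥0 → Set
p ≤ℝ x = ∀ q → x q → p ℚ.≤ q

-- qᵏ / k!
expTerm : ℚ → ℕ → ℚ
expTerm q zero    = 1ℚ
expTerm q (suc k) = expTerm q k ℚ.* (q ℚ.* (+ 1 ℚ./ suc k))

-- Σ_{k ≤ N} qᵏ / k!
expSum : ℚ → ℕ → ℚ
expSum q zero    = expTerm q zero
expSum q (suc N) = expSum q N ℚ.+ expTerm q (suc N)

-- For n ≥ 1 (so that ln n ≥ 0):  ln n < q  iff  q > 0 and n < e^q.
-- As q > 0 the partial sums of e^q increase, so n < e^q iff one of
-- them exceeds n.
ln : ℕ → ℝ≥0
ln n q = 0ℚ ℚ.< q × ∃[ N ] fromℕℚ n ℚ.< expSum q N

-- For n ≥ 1 (so that log₂ n ≥ 0):  log₂ n < u / v  iff  u / v > 0 and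
-- n < 2^(u / v), that is, nᵛ < 2ᵘ.
log₂ : ℕ → ℝ≥0
log₂ n q = 0ℚ ℚ.< q × n ℕ.^ (↧ₙ q) ℕ.< 2 ℕ.^ ℤ.∣ ↥ q ∣

------------------------------------------------------------------------
-- Heaps and Root lists

-- Tree K k has 2ᵏ nodes. Its root has k children, of sizes
-- 2⁰, …, 2ᵏ⁻¹, the largest being added last.

data Tree (K : Set a) : ℕ → Set a
data Children (K : Set a) : ℕ → Set a

data Tree K where
  node : K → Children K k → Tree K k

infixl 5 _▹_

data Children K where
  []  : Children K zero
  _▹_ : Children K k → Tree K k → Children K (suc k)

-- RootList K s is a list of trees ordered by size, with at most one of
-- each of the sizes 2ˢ, 2ˢ⁺¹, …; skip records that there is none of
-- size 2ˢ (a digit 0 in the binary expansion).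

infixr 5 _∷_

data RootList (K : Set a) : ℕ → Set a where
  []   : RootList K s
  skip : RootList K (suc s) → RootList K s
  _∷_  : Tree K s → RootList K (suc s) → RootList K s

Queue : Set a → Set a
Queue K = RootList K zero

module _ {K : Set a} where

  root : Tree K k → K
  root (node x _) = x

  rootKeys : RootList K s → List K
  rootKeys []       = []
  rootKeys (skip q) = rootKeys q
  rootKeys (t ∷ q)  = root t ∷ rootKeys q

  childList : Tree K k → Queue K
  childList (node _ ts) = go ts []
    where
    go : Children K k → RootList K k → Queue K
    go []       q = q
    go (ts ▹ t) q = go ts (t ∷ q)

------------------------------------------------------------------------
-- All ways of placing keys in the nodes

module _ {K : Set a} where

  private
    _>>=_ : {A B : Set a} → List A → (A → List B) → List B
    _>>=_ = flip concatMap

  -- Each function returns every way of filling a shape with keys at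
  -- distinct positions of the given list, paired with the unused keys.

  pick : List K → List (K × List K)
  pick []       = []
  pick (x ∷ xs) = (x , xs) ∷ map (map₂ (x ∷_)) (pick xs)

  fillTree     : ∀ k → List K → List (Tree K k × List K)
  fillChildren : ∀ k → List K → List (Children K k × List K)

  fillTree k xs = do
    x  , ys ← pick xs
    ts , zs ← fillChildren k ys
    [ node x ts , zs ]

  fillChildren zero    xs = [ [] , xs ]
  fillChildren (suc k) xs = do
    ts , ys ← fillChildren k xs
    t  , zs ← fillTree k ys
    [ ts ▹ t , zs ]

  -- The digits are those of sizes 2ˢ, 2ˢ⁺¹, …
  fillRootList : ∀ s → Expansion 2 → List K → List (RootList K s × List K)
  fillRootList s []              xs = [ [] , xs ]
  fillRootList s (zero     ∷ ds) xs = map (map₁ skip) (fillRootList (suc s) ds xs)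
  fillRootList s (suc zero ∷ ds) xs = do
    t , ys ← fillTree s xs
    q , zs ← fillRootList (suc s) ds ys
    [ t ∷ q , zs ]

  -- No keys are left over, since the number of nodes is length keys.
  placements : List K → List (Queue K)
  placements keys =
    map proj₁ (fillRootList zero (proj₁ (toDigits 2 (length keys))) keys)

-- The expected value of f under the uniform distribution on the entries
-- of a list; the value for the empty list is a dummy.
expectation : {A : Set a} → List A → (A → ℕ) → ℚ
expectation []          f = 0ℚ
expectation xs@(_ ∷ _)  f = + sum (map f xs) ℚ./ length xs

------------------------------------------------------------------------
-- Binomial heaps over a totally ordered set of keys

module BinomialHeap {K : Set a} {_≺_ : Rel K ℓ}
                    (isSTO : IsStrictTotalOrder _≡_ _≺_) where

  open IsStrictTotalOrder isSTO using (_≟_) renaming (_<?_ to _≺?_)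
  open DecMembership _≟_ using (_∈?_)

  data HeapOrdered : Tree K k → Set (a ⊔ ℓ)
  data HeapOrderedBelow (x : K) : Children K k → Set (a ⊔ ℓ)

  data HeapOrdered where
    node : ∀ {x} {ts : Children K k} →
           HeapOrderedBelow x ts → HeapOrdered (node x ts)

  data HeapOrderedBelow x where
    []  : HeapOrderedBelow x []
    _▹_ : {ts : Children K k} {t : Tree K k} →
          HeapOrderedBelow x ts → root t ≺ x × HeapOrdered t →
          HeapOrderedBelow x (ts ▹ t)

  data AllHeapOrdered : RootList K s → Set (a ⊔ ℓ) where
    []   : AllHeapOrdered {s} []
    skip : {q : RootList K (suc s)} → AllHeapOrdered q → AllHeapOrdered (skip q)
    _∷_  : {t : Tree K s} {q : RootList K (suc s)} →
           HeapOrdered t → AllHeapOrdered q → AllHeapOrdered (t ∷ q)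

  heapOrdered?      : (t : Tree K k) → Dec (HeapOrdered t)
  heapOrderedBelow? : ∀ x (ts : Children K k) → Dec (HeapOrderedBelow x ts)

  heapOrdered? (node x ts) =
    map′ node (λ { (node h) → h }) (heapOrderedBelow? x ts)

  heapOrderedBelow? x []       = yes []
  heapOrderedBelow? x (ts ▹ t) =
    map′ (λ (hs , h) → hs ▹ h) (λ { (hs ▹ h) → hs , h })
         (heapOrderedBelow? x ts ×-dec ((root t ≺? x) ×-dec heapOrdered? t))

  allHeapOrdered? : (q : RootList K s) → Dec (AllHeapOrdered q)
  allHeapOrdered? []       = yes []
  allHeapOrdered? (skip q) = map′ skip (λ { (skip h) → h }) (allHeapOrdered? q)
  allHeapOrdered? (t ∷ q)  =
    map′ (λ (h , hs) → h ∷ hs) (λ { (h ∷ hs) → h , hs })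
         (heapOrdered? t ×-dec allHeapOrdered? q)

  -- For distinct keys this is non-empty and has no repetitions, so that
  -- a uniformly random priority queue is a uniformly random entry of it.
  configurations : List K → List (Queue K)
  configurations keys = filter allHeapOrdered? (placements keys)

  join : Tree K k → Tree K k → Tree K (suc k)
  join t@(node x ts) u@(node y us) =
    if does (x ≺? y) then node y (us ▹ t) else node x (ts ▹ u)

  addCarry : Tree K s → RootList K s → RootList K s
  addCarry c []       = c ∷ []
  addCarry c (skip q) = c ∷ q
  addCarry c (u ∷ q)  = skip (addCarry (join c u) q)

  merge      : RootList K s → RootList K s → RootList K s
  mergeCarry : Tree K s → RootList K s → RootList K s → RootList K s

  merge []       q        = q
  merge (skip p) []       = skip p
  merge (t ∷ p)  []       = t ∷ p
  merge (skip p) (skip q) = skip (merge p q)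
  merge (skip p) (u ∷ q)  = u ∷ merge p q
  merge (t ∷ p)  (skip q) = t ∷ merge p q
  merge (t ∷ p)  (u ∷ q)  = skip (mergeCarry (join t u) p q)

  mergeCarry c []       q        = addCarry c q
  mergeCarry c (skip p) []       = addCarry c (skip p)
  mergeCarry c (t ∷ p)  []       = addCarry c (t ∷ p)
  mergeCarry c (skip p) (skip q) = c ∷ merge p q
  mergeCarry c (skip p) (u ∷ q)  = skip (mergeCarry (join c u) p q)
  mergeCarry c (t ∷ p)  (skip q) = skip (mergeCarry (join c t) p q)
  mergeCarry c (t ∷ p)  (u ∷ q)  = c ∷ mergeCarry (join t u) p q

  -- scan m xs compares each entry of xs in turn with the current
  -- maximum, initially m; it returns the final maximum and the
  -- comparisons made.
  scan : K → List K → K × List (K × K)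
  scan m []       = m , []
  scan m (x ∷ xs) =
    map₂ ((m , x) ∷_) (scan (if does (m ≺? x) then x else m) xs)

  -- Removes the tree with root m from the list, returning the remaining
  -- list and the list of the children of m.
  extract : K → RootList K s → RootList K s × Queue K
  extract m []       = [] , []
  extract m (skip q) = map₁ skip (extract m q)
  extract m (t ∷ q)  =
    if does (root t ≟ m) then (skip q , childList t)
                         else map₁ (t ∷_) (extract m q)

  -- The queue after deletion of the maximum, and the comparisons made
  -- in searching for it.
  deleteMax : Queue K → Queue K × List (K × K)
  deleteMax q with rootKeys q
  ... | []     = q , []
  ... | x ∷ xs =
    let m    , comparisons = scan x xs
        rest , children    = extract m q
    in  merge children rest , comparisons

  searchComparisons : ℕ → Queue K → List (K × K)
  searchComparisons zero    q = []
  searchComparisons (suc r) q =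
    let q′ , comparisons = deleteMax q
    in  comparisons ++ searchComparisons r q′

  -- The r largest keys: those smaller than fewer than r others.
  largest : ℕ → List K → List K
  largest r keys =
    filter (λ x → length (filter (x ≺?_) keys) ℕ.<? r) keys

  countWithin : List K → List (K × K) → ℕ
  countWithin X = length ∘ filter (λ (x , y) → (x ∈? X) ×-dec (y ∈? X))

  expectedSearchComparisons : ℕ → List K → ℚ
  expectedSearchComparisons r keys =
    expectation (configurations keys)
                (λ q → countWithin (largest r keys) (searchComparisons r q))

{-# OPTIONS --safe #-}
-- Uniformity is used only through a symmetry. Relabelling the keys of all
-- tournaments by the transposition of two keys x and y, and replaying them,
-- is an involution on the configurations. As long as neither x nor y has been
-- deleted, it commutes with deletion of the maximum, because the tree shapes
-- and the places of the maxima do not change. Hence after i deletions all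
-- remaining keys are equally likely to lie in any given part of the queue.
--
-- If ρ ≥ 1 roots belong to X_r, a search makes at most ρ - 1 comparisons within
-- X_r. At most k of these roots are roots of the k largest trees; the other
-- trees hold at most a fraction 2⁻ᵏ of the keys, hence on average at most
-- r / 2ᵏ of the keys in X_r. With r = 2ᵏ + b, 0 ≤ b ≤ 2ᵏ, a search makes on
-- average at most k + r / 2ᵏ - 1 = k + b / 2ᵏ ≤ log₂ r such comparisons, and
-- 1 ≤ 2 ln 2.
module Submission where

open import Defs
import Algebra.Properties.CommutativeSemigroup as CommutativeSemigroupProperties
import Algebra.Solver.CommutativeMonoid as CommutativeMonoidSolver
open import Data.Digit using (Expansion; fromDigits; toDigits)
open import Data.Fin.Base using (zero; suc)
import Data.Integer.Base as ℤ
import Data.Integer.Properties as ℤ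
open import Data.List.Base using (List; []; _∷_; _++_; [_]; concatMap; filter; length; map)
open import Data.List.Properties
  using (++-assoc; ++-identityʳ; filter-++; length-++; length-filter; map-++; map-cong-local; map-∘; ∷-injectiveʳ)
import Data.List.Membership.DecPropositional as DecMembership
open import Data.List.Membership.Propositional using (_∈_; _∉_; find; lose)
open import Data.List.Membership.Propositional.Properties
  using (∈-++⁺ˡ; ∈-++⁺ʳ; ∈-++⁻; ∈-concatMap⁺; ∈-concatMap⁻; ∈-filter⁺; ∈-filter⁻; ∈-map⁺; ∈-map⁻)
open import Data.List.Membership.Propositional.Properties.WithK using (unique∧set⇒bag)
open import Data.List.Relation.Binary.BagAndSetEquality using (∼bag⇒↭)
open import Data.List.Relation.Binary.Permutation.Propositional
  using (_↭_; ↭-refl; ↭-sym; ↭-trans; ↭-prep; ↭-swap; ↭-reflexive; ↭⇒↭ₛ; module PermutationReasoning)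
import Data.List.Relation.Binary.Permutation.Propositional.Properties as ↭
import Data.List.Relation.Binary.Permutation.Setoid.Properties as ↭ₛ
open import Data.List.Relation.Unary.All as All using (All; []; _∷_)
import Data.List.Relation.Unary.All.Properties as All
open import Data.List.Relation.Unary.AllPairs using ([]; _∷_)
open import Data.List.Relation.Unary.Any using (here; there)
open import Data.List.Relation.Unary.Unique.Propositional using (Unique)
import Data.List.Relation.Unary.Unique.Propositional.Properties as Unique
open import Data.Nat.Base as ℕ
  using (ℕ; zero; suc; _+_; _*_; _∸_; _^_; _≤_; _<_; z≤n; s≤s; NonZero)
open import Data.Nat.ListAction using (sum)
open import Data.Nat.ListAction.Properties using (sum-↭)
import Data.Nat.Properties as ℕ
open import Data.Nat.Solver using (module +-*-Solver)
open import Data.Product.Base using (∃₂; ∃-syntax; _×_; _,_; proj₁; proj₂; map₁; map₂)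
open import Data.Rational.Base as ℚ using (ℚ; 0ℚ; 1ℚ; ½; ↥_; ↧ₙ_)
import Data.Rational.Properties as ℚ
import Data.Rational.Unnormalised.Base as ℚᵘ
import Data.Rational.Unnormalised.Properties as ℚᵘ
open import Data.Sum.Base using (_⊎_; inj₁; inj₂)
open import Data.Unit.Base using (⊤; tt)
open import Function.Base using (_∘_; flip; id)
open import Function.Bundles using (mk⇔)
open import Level using (Level; _⊔_)
open import Relation.Binary.Core using (Rel)
open import Relation.Binary.Definitions
  using (DecidableEquality; Transitive; Tri; tri<; tri≈; tri>)
open import Relation.Binary.PropositionalEquality hiding ([_])
open import Relation.Binary.Structures using (IsStrictTotalOrder)
open import Relation.Nullary using (¬_; contradiction; yes; no)
open import Relation.Unary using (Decidable; Pred)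

-- Relabelling nodes in place would break the heap order, and replaying the matches can change their
-- winners, so a configuration and its image may have differently arranged subtrees. They are
-- compared by a relation, `Linked`, which records only that two trees result from one schedule of
-- matches. Since a match is one of its constructors, the relation passes through every merge with
-- no condition on the order of the keys. In following a deletion, the order matters only where the
-- tree of the maximum `m` is taken apart, through `g m ≡ m` and the fact that `g` keeps keys below
-- `m` below `m`. The same relation, for the trivial transposition, takes the place of heap order in
-- the queues left by deletions.
--
-- Expectations are kept as sums over the list of configurations, with denominators multiplied out.
-- The -1 of each search then becomes a term added on the left, which in the end cancels the summand
-- `2 ^ k` of `r`.

private
  variable
    a b ℓ : Level
    A : Set a
    B : Set b
    k s : ℕ

-- Real bounds

even⊎odd : ∀ n → ∃[ m ] (n ≡ m + m ⊎ n ≡ suc (m + m))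
even⊎odd zero = zero , inj₁ refl
even⊎odd (suc n) with even⊎odd n
... | m , inj₁ refl = m , inj₂ refl
... | m , inj₂ refl = suc m , inj₁ (cong suc (sym (ℕ.+-suc m m)))

-- The remainder may reach `2 ^ k`. At such a power of two the interpolation `k + a / 2ᵏ` takes the
-- right value `k + 1`, so either representation serves.
floor-log₂ : ∀ r → 1 ≤ r → ∃₂ λ k a → a ≤ 2 ^ k × r ≡ 2 ^ k + a
floor-log₂ 1 _ = 0 , 0 , z≤n , refl
floor-log₂ (suc r@(suc _)) _ with floor-log₂ r (s≤s z≤n)
... | k , a , a≤2ᵏ , eq with a ℕ.≟ 2 ^ k
... | no a≢2ᵏ = k , suc a , ℕ.≤∧≢⇒< a≤2ᵏ a≢2ᵏ ,
                trans (cong suc eq) (sym (ℕ.+-suc (2 ^ k) a))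
... | yes refl = suc k , 1 , ℕ.m^n>0 2 (suc k) , (begin
  suc r                       ≡⟨ cong suc eq ⟩
  suc (2 ^ k + 2 ^ k)         ≡⟨ cong (λ z → suc (2 ^ k + z)) (ℕ.+-identityʳ _) ⟨
  suc (2 ^ suc k)             ≡⟨ ℕ.+-comm 1 _ ⟩
  2 ^ suc k + 1               ∎)
  where open ≡-Reasoning

^-double : ∀ m n → m ^ (2 * n) ≡ m ^ n * m ^ n
^-double m n = trans (cong (λ z → m ^ (n + z)) (ℕ.+-identityʳ n))
                     (ℕ.^-distribˡ-+-* m n n)

^-distribʳ-* : ∀ m n o → (m * n) ^ o ≡ m ^ o * n ^ o
^-distribʳ-* m n zero = refl
^-distribʳ-* m n (suc o) = trans (cong (m * n *_) (^-distribʳ-* m n o))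
  (ℕ.[m*n]*[o*p]≡[m*o]*[n*p] m n (m ^ o) (n ^ o))

-- Each bracket is the left-hand side of the bound below for `N`, times `2 ^ N`. The exponent
-- `b + c` is split into its two halves, where `c` is `b` or `suc b`.
2ᵇ⁺ᶜ[2N]²ᴺ : ∀ N b c → 2 ^ (b + c) * (2 * N) ^ (2 * N) ≡
  (2 ^ N * (2 ^ b * N ^ N)) * (2 ^ N * (2 ^ c * N ^ N))
2ᵇ⁺ᶜ[2N]²ᴺ N b c rewrite ^-double (2 * N) N | ^-distribʳ-* 2 N N | ℕ.^-distribˡ-+-* 2 b c =
  solve 4 (λ p q t n → (p :* q) :* ((t :* n) :* (t :* n)) :=
                       (t :* (p :* n)) :* (t :* (q :* n)))
        refl (2 ^ b) (2 ^ c) (2 ^ N) (N ^ N)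
  where open +-*-Solver

-- 2ʸ ≤ 1 + y for y = a / N ∈ [0, 1] and N = 2ᵏ. Doubling N inserts the
-- midpoints, where (x + 1)² ≥ x (x + 2) gives the bound.
2ᵃNᴺ≤[N+a]ᴺ : ∀ k a → a ≤ 2 ^ k →
  2 ^ a * (2 ^ k) ^ (2 ^ k) ≤ (2 ^ k + a) ^ (2 ^ k)
2ᵃNᴺ≤[N+a]ᴺ zero zero    _       = ℕ.≤-refl
2ᵃNᴺ≤[N+a]ᴺ zero (suc .zero) (s≤s z≤n) = ℕ.≤-refl
2ᵃNᴺ≤[N+a]ᴺ (suc k) a a≤2N with even⊎odd a
... | b , inj₁ refl = begin
  2 ^ (b + b) * (2 * N) ^ (2 * N)                        ≡⟨ 2ᵇ⁺ᶜ[2N]²ᴺ N b b ⟩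
  (2 ^ N * (2 ^ b * N ^ N)) * (2 ^ N * (2 ^ b * N ^ N))  ≤⟨ ℕ.*-mono-≤ ih ih ⟩
  (2 ^ N * (N + b) ^ N) * (2 ^ N * (N + b) ^ N)
    ≡⟨ cong₂ _*_ (^-distribʳ-* 2 (N + b) N) (^-distribʳ-* 2 (N + b) N) ⟨
  (2 * (N + b)) ^ N * (2 * (N + b)) ^ N                  ≡⟨ ^-double (2 * (N + b)) N ⟨
  (2 * (N + b)) ^ (2 * N)
    ≡⟨ cong (_^ (2 * N)) (solve 2 (λ N b → con 2 :* (N :+ b) := con 2 :* N :+ (b :+ b)) refl N b) ⟩
  (2 * N + (b + b)) ^ (2 * N)                            ∎
  where
  open ℕ.≤-Reasoning
  open +-*-Solver
  N = 2 ^ k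
  b≤N : b ≤ N
  b≤N = ℕ.*-cancelˡ-≤ 2 (subst (_≤ 2 * N) (cong (b +_) (sym (ℕ.+-identityʳ b))) a≤2N)
  ih : 2 ^ N * (2 ^ b * N ^ N) ≤ 2 ^ N * (N + b) ^ N
  ih = ℕ.*-monoʳ-≤ (2 ^ N) (2ᵃNᴺ≤[N+a]ᴺ k b b≤N)
... | b , inj₂ refl = begin
  2 ^ suc (b + b) * (2 * N) ^ (2 * N)
    ≡⟨ cong (λ z → 2 ^ z * (2 * N) ^ (2 * N)) (ℕ.+-suc b b) ⟨
  2 ^ (b + suc b) * (2 * N) ^ (2 * N)                    ≡⟨ 2ᵇ⁺ᶜ[2N]²ᴺ N b (suc b) ⟩
  (2 ^ N * (2 ^ b * N ^ N)) * (2 ^ N * (2 ^ suc b * N ^ N))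
    ≤⟨ ℕ.*-mono-≤ (ih b (ℕ.<⇒≤ b<N)) (ih (suc b) b<N) ⟩
  (2 ^ N * (N + b) ^ N) * (2 ^ N * (N + suc b) ^ N)
    ≡⟨ cong₂ _*_ (^-distribʳ-* 2 (N + b) N) (^-distribʳ-* 2 (N + suc b) N) ⟨
  (2 * (N + b)) ^ N * (2 * (N + suc b)) ^ N              ≡⟨ ^-distribʳ-* (2 * (N + b)) (2 * (N + suc b)) N ⟨
  (2 * (N + b) * (2 * (N + suc b))) ^ N
    ≤⟨ ℕ.^-monoˡ-≤ N (ℕ.≤-trans (ℕ.n≤1+n _) (ℕ.≤-reflexive (midpoint N b))) ⟩
  ((2 * N + suc (b + b)) * (2 * N + suc (b + b))) ^ N
    ≡⟨ ^-distribʳ-* (2 * N + suc (b + b)) (2 * N + suc (b + b)) N ⟩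
  (2 * N + suc (b + b)) ^ N * (2 * N + suc (b + b)) ^ N  ≡⟨ ^-double (2 * N + suc (b + b)) N ⟨
  (2 * N + suc (b + b)) ^ (2 * N)                        ∎
  where
  open ℕ.≤-Reasoning
  open +-*-Solver
  N = 2 ^ k
  b<N : b < N
  b<N = ℕ.*-cancelˡ-< 2 _ _ (subst (_< 2 * N) (cong (b +_) (sym (ℕ.+-identityʳ b))) a≤2N)
  ih : ∀ c → c ≤ N → 2 ^ N * (2 ^ c * N ^ N) ≤ 2 ^ N * (N + c) ^ N
  ih c c≤N = ℕ.*-monoʳ-≤ (2 ^ N) (2ᵃNᴺ≤[N+a]ᴺ k c c≤N)
  midpoint : ∀ N b → suc (2 * (N + b) * (2 * (N + suc b))) ≡
             (2 * N + suc (b + b)) * (2 * N + suc (b + b))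
  midpoint = solve 2 (λ N b → con 1 :+ con 2 :* (N :+ b) :* (con 2 :* (N :+ (con 1 :+ b))) :=
    (con 2 :* N :+ (con 1 :+ (b :+ b))) :* (con 2 :* N :+ (con 1 :+ (b :+ b)))) refl

^-cancelʳ-< : ∀ b m n → .{{NonZero b}} → b ^ m < b ^ n → m < n
^-cancelʳ-< b m n bᵐ<bⁿ with m ℕ.<? n
... | yes m<n = m<n
... | no  m≮n = contradiction bᵐ<bⁿ (ℕ.≤⇒≯ (ℕ.^-monoʳ-≤ b (ℕ.≮⇒≥ m≮n)))

-- log₂ r < u / v bounds the piecewise linear interpolation
-- k + a / 2ᵏ of log₂ at r = 2ᵏ + a.
log₂-interpolation : ∀ k a u v → a ≤ 2 ^ k → (2 ^ k + a) ^ v < 2 ^ u →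
  v * (k * 2 ^ k + a) ≤ u * 2 ^ k
log₂-interpolation k a u v a≤N rᵛ<2ᵘ = ℕ.<⇒≤ (^-cancelʳ-< 2 _ _ (begin-strict
  2 ^ (v * (k * N + a))          ≡⟨ cong (2 ^_) (ℕ.*-comm v (k * N + a)) ⟩
  2 ^ ((k * N + a) * v)          ≡⟨ ℕ.^-*-assoc 2 (k * N + a) v ⟨
  (2 ^ (k * N + a)) ^ v
    ≡⟨ cong (_^ v) (trans (ℕ.^-distribˡ-+-* 2 (k * N) a) (ℕ.*-comm (2 ^ (k * N)) (2 ^ a))) ⟩
  (2 ^ a * 2 ^ (k * N)) ^ v      ≡⟨ cong (λ z → (2 ^ a * z) ^ v) (ℕ.^-*-assoc 2 k N) ⟨
  (2 ^ a * N ^ N) ^ v            ≤⟨ ℕ.^-monoˡ-≤ v (2ᵃNᴺ≤[N+a]ᴺ k a a≤N) ⟩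
  ((N + a) ^ N) ^ v              ≡⟨ ℕ.^-*-assoc (N + a) N v ⟩
  (N + a) ^ (N * v)              ≡⟨ cong ((N + a) ^_) (ℕ.*-comm N v) ⟩
  (N + a) ^ (v * N)              ≡⟨ ℕ.^-*-assoc (N + a) v N ⟨
  ((N + a) ^ v) ^ N              <⟨ ℕ.^-monoˡ-< N {{ℕ.>-nonZero (ℕ.m^n>0 2 k)}} rᵛ<2ᵘ ⟩
  (2 ^ u) ^ N                    ≡⟨ ℕ.^-*-assoc 2 u N ⟩
  2 ^ (u * N)                    ∎))
  where
  open ℕ.≤-Reasoning
  N = 2 ^ k

½^_ : ℕ → ℚ
½^ zero  = 1ℚ
½^ suc k = ½^ k ℚ.* ½

0≤½^ : ∀ k → 0ℚ ℚ.≤ ½^ k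
0≤½^ zero    = ℚ.nonNegative⁻¹ 1ℚ
0≤½^ (suc k) = subst (ℚ._≤ ½^ suc k) (ℚ.*-zeroˡ ½)
                     (ℚ.*-monoʳ-≤-nonNeg ½ (0≤½^ k))

½^-double : ∀ k → ½^ suc k ℚ.+ ½^ suc k ≡ ½^ k
½^-double k = trans (sym (ℚ.*-distribˡ-+ (½^ k) ½ ½)) (ℚ.*-identityʳ (½^ k))

1/[1+k]≤1 : ∀ k → ℤ.+ 1 ℚ./ suc k ℚ.≤ 1ℚ
1/[1+k]≤1 k = ℚ.toℚᵘ-cancel-≤ (ℚᵘ.≤-trans
  (ℚᵘ.≤-reflexive (ℚ.toℚᵘ-fromℚᵘ (ℚᵘ.mkℚᵘ (ℤ.+ 1) k)))
  (ℚᵘ.*≤* (ℤ.+≤+ (s≤s z≤n))))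

module _ (q : ℚ) (0<q : 0ℚ ℚ.< q) (q≤½ : q ℚ.≤ ½) where

  private instance
    q≥0 : ℚ.NonNegative q
    q≥0 = ℚ.nonNegative (ℚ.<⇒≤ 0<q)

  expTerm≤½^ : ∀ k → expTerm q k ℚ.≤ ½^ k
  expTerm≤½^ zero    = ℚ.≤-refl
  expTerm≤½^ (suc k) = begin
    expTerm q k ℚ.* factor  ≤⟨ ℚ.*-monoʳ-≤-nonNeg factor {{ℚ.nonNegative 0≤factor}} (expTerm≤½^ k) ⟩
    ½^ k ℚ.* factor         ≤⟨ ℚ.*-monoˡ-≤-nonNeg (½^ k) {{ℚ.nonNegative (0≤½^ k)}} factor≤½ ⟩
    ½^ k ℚ.* ½              ∎
    where
    open ℚ.≤-Reasoning
    factor = q ℚ.* (ℤ.+ 1 ℚ./ suc k)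
    0≤factor : 0ℚ ℚ.≤ factor
    0≤factor = subst (ℚ._≤ factor) (ℚ.*-zeroʳ q)
      (ℚ.*-monoˡ-≤-nonNeg q (ℚ.nonNegative⁻¹ (ℤ.+ 1 ℚ./ suc k) {{ℚ.normalize-nonNeg 1 (suc k)}}))
    factor≤½ : factor ℚ.≤ ½
    factor≤½ = ℚ.≤-trans (ℚ.*-monoˡ-≤-nonNeg q (1/[1+k]≤1 k))
                         (ℚ.≤-trans (ℚ.≤-reflexive (ℚ.*-identityʳ q)) q≤½)

  -- Domination by the geometric series. The summand `½^ N`, the tail still to come, makes the
  -- induction work: the next term uses up at most half of it.
  expSum≤2-½^ : ∀ N → expSum q N ℚ.+ ½^ N ℚ.≤ fromℕℚ 2
  expSum≤2-½^ zero    = ℚ.≤-refl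
  expSum≤2-½^ (suc N) = begin
    expSum q N ℚ.+ expTerm q (suc N) ℚ.+ ½^ suc N
      ≤⟨ ℚ.+-monoˡ-≤ (½^ suc N) (ℚ.+-monoʳ-≤ (expSum q N) (expTerm≤½^ (suc N))) ⟩
    expSum q N ℚ.+ ½^ suc N ℚ.+ ½^ suc N           ≡⟨ ℚ.+-assoc (expSum q N) (½^ suc N) (½^ suc N) ⟩
    expSum q N ℚ.+ (½^ suc N ℚ.+ ½^ suc N)         ≡⟨ cong (expSum q N ℚ.+_) (½^-double N) ⟩
    expSum q N ℚ.+ ½^ N                            ≤⟨ expSum≤2-½^ N ⟩
    fromℕℚ 2                                       ∎
    where open ℚ.≤-Reasoning

  expSum≤2 : ∀ N → expSum q N ℚ.≤ fromℕℚ 2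
  expSum≤2 N = begin
    expSum q N           ≡⟨ ℚ.+-identityʳ (expSum q N) ⟨
    expSum q N ℚ.+ 0ℚ    ≤⟨ ℚ.+-monoʳ-≤ (expSum q N) (0≤½^ N) ⟩
    expSum q N ℚ.+ ½^ N  ≤⟨ expSum≤2-½^ N ⟩
    fromℕℚ 2             ∎
    where open ℚ.≤-Reasoning

-- For `q` at most `½` the exponential series stays below 1 + 1/2 + 1/4 + ... = 2, so no partial sum
-- can exceed 2, as membership in the cut demands.
½≤ln2 : ½ ≤ℝ ln 2
½≤ln2 q (0<q , N , 2<expSum) with ℚ.≤-total ½ q
... | inj₁ ½≤q = ½≤q
... | inj₂ q≤½ = contradiction (ℚ.<-≤-trans 2<expSum (expSum≤2 q 0<q q≤½ N)) (ℚ.<-irrefl refl)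

-- Only 2 ln 2 ≥ 1 is used.
rlog₂r≤2ln2rlog₂r : ∀ p r →
  (∀ q → log₂ r q → p ℚ.≤ fromℕℚ r ℚ.* q) →
  p ≤ℝ fromℕ 2 · ln 2 · fromℕ r · log₂ r
rlog₂r≤2ln2rlog₂r p r p≤ _
  (_ , d , (_ , c , (a , b , 2<a , ln2<b , refl) , r<c , refl) , log₂r<d@(0<d , _) , refl) = begin
    p                        ≤⟨ p≤ d log₂r<d ⟩
    fromℕℚ r ℚ.* d           ≡⟨ cong (ℚ._* d) (ℚ.*-identityˡ (fromℕℚ r)) ⟨
    1ℚ ℚ.* fromℕℚ r ℚ.* d    ≤⟨ ℚ.*-monoʳ-≤-nonNeg d {{d≥0}} (ℚ.*-monoʳ-≤-nonNeg (fromℕℚ r) {{r≥0}} 1≤ab) ⟩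
    a ℚ.* b ℚ.* fromℕℚ r ℚ.* d
      ≤⟨ ℚ.*-monoʳ-≤-nonNeg d {{d≥0}} (ℚ.*-monoˡ-≤-nonNeg (a ℚ.* b) {{ℚ.nonNegative (ℚ.≤-trans (ℚ.nonNegative⁻¹ 1ℚ) 1≤ab)}} (ℚ.<⇒≤ r<c)) ⟩
    a ℚ.* b ℚ.* c ℚ.* d      ∎
  where
  open ℚ.≤-Reasoning
  d≥0 = ℚ.nonNegative (ℚ.<⇒≤ 0<d)
  r≥0 = ℚ.normalize-nonNeg r 1
  ½≤b : ½ ℚ.≤ b
  ½≤b = ½≤ln2 b ln2<b
  1≤ab : 1ℚ ℚ.≤ a ℚ.* b
  -- `fromℕℚ 2 ℚ.* ½` evaluates to `1ℚ`.
  1≤ab = ℚ.≤-trans (ℚ.*-monoˡ-≤-nonNeg (fromℕℚ 2) ½≤b)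
    (ℚ.*-monoʳ-≤-nonNeg b {{ℚ.nonNegative (ℚ.≤-trans (ℚ.nonNegative⁻¹ ½) ½≤b)}} (ℚ.<⇒≤ 2<a))

-- Cross-multiplication. The numerator appears as an absolute value because that is how `log₂` reads
-- it; positivity of `q` makes the two agree.
/-≤-* : ∀ t c r q → .{{_ : NonZero c}} → 0ℚ ℚ.< q →
  t * ↧ₙ q ≤ r * ℤ.∣ ↥ q ∣ * c → ℤ.+ t ℚ./ c ℚ.≤ fromℕℚ r ℚ.* q
/-≤-* t (suc c) r q@(ℚ.mkℚ (ℤ.+ u) v _) 0<q tv≤ruc = ℚ.toℚᵘ-cancel-≤ (begin
  ℚ.toℚᵘ (ℤ.+ t ℚ./ suc c)          ≃⟨ ℚ.toℚᵘ-fromℚᵘ (ℚᵘ.mkℚᵘ (ℤ.+ t) c) ⟩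
  ℚᵘ.mkℚᵘ (ℤ.+ t) c                 ≤⟨ ℚᵘ.*≤* cross ⟩
  ℚᵘ.mkℚᵘ (ℤ.+ r) 0 ℚᵘ.* ℚ.toℚᵘ q    ≃⟨ ℚᵘ.*-congʳ {ℚ.toℚᵘ q} (ℚ.toℚᵘ-fromℚᵘ (ℚᵘ.mkℚᵘ (ℤ.+ r) 0)) ⟨
  ℚ.toℚᵘ (fromℕℚ r) ℚᵘ.* ℚ.toℚᵘ q    ≃⟨ ℚ.toℚᵘ-homo-* (fromℕℚ r) q ⟨
  ℚ.toℚᵘ (fromℕℚ r ℚ.* q)           ∎)
  where
  open ℚᵘ.≤-Reasoning
  cross : ℤ.+ t ℤ.* ℤ.+ (suc v + 0) ℤ.≤ ℤ.+ r ℤ.* ℤ.+ u ℤ.* ℤ.+ suc c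
  cross rewrite ℕ.+-identityʳ v | sym (ℤ.pos-* t (suc v)) | sym (ℤ.pos-* r u) | sym (ℤ.pos-* (r * u) (suc c)) = ℤ.+≤+ tv≤ruc
/-≤-* t (suc c) r (ℚ.mkℚ ℤ.-[1+ u ] v _) (ℚ.*<* ()) _

-- Lists and finite sums

Unique-resp-↭ : {xs ys : List A} → xs ↭ ys → Unique xs → Unique ys
Unique-resp-↭ σ = ↭ₛ.Unique-resp-↭ (setoid _) (↭⇒↭ₛ σ)

Unique-++⁻ˡ : ∀ (xs : List A) {ys} → Unique (xs ++ ys) → Unique xs
Unique-++⁻ˡ []       _               = []
Unique-++⁻ˡ (x ∷ xs) (x∉ ∷ xs++ys!) = All.++⁻ˡ xs x∉ ∷ Unique-++⁻ˡ xs xs++ys!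

Unique-++⁻ʳ : ∀ (xs : List A) {ys} → Unique (xs ++ ys) → Unique ys
Unique-++⁻ʳ []       ys!           = ys!
Unique-++⁻ʳ (x ∷ xs) (_ ∷ xs++ys!) = Unique-++⁻ʳ xs xs++ys!

Unique-++⇒≢ : ∀ (xs : List A) {ys x y} → Unique (xs ++ ys) → x ∈ xs → y ∈ ys → x ≢ y
Unique-++⇒≢ (x ∷ xs) (x∉ ∷ _)       (here refl) y∈ = All.lookup (All.++⁻ʳ xs x∉) y∈
Unique-++⇒≢ (x ∷ xs) (_ ∷ xs++ys!) (there x∈)  y∈ = Unique-++⇒≢ xs xs++ys! x∈ y∈

∑ : List A → (A → ℕ) → ℕ
∑ xs f = sum (map f xs)

∑-mono : ∀ (xs : List A) {f g} → (∀ {x} → x ∈ xs → f x ≤ g x) → ∑ xs f ≤ ∑ xs g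
∑-mono []       f≤g = z≤n
∑-mono (x ∷ xs) f≤g = ℕ.+-mono-≤ (f≤g (here refl)) (∑-mono xs (f≤g ∘ there))

∑-cong : ∀ (xs : List A) {f g} → (∀ {x} → x ∈ xs → f x ≡ g x) → ∑ xs f ≡ ∑ xs g
∑-cong xs f≡g = cong sum (map-cong-local (All.tabulate f≡g))

∑-const : ∀ (xs : List A) c → ∑ xs (λ _ → c) ≡ length xs * c
∑-const []       c = refl
∑-const (x ∷ xs) c = cong (c +_) (∑-const xs c)

∑-+ : ∀ (xs : List A) f g → ∑ xs (λ x → f x + g x) ≡ ∑ xs f + ∑ xs g
∑-+ []       f g = refl
∑-+ (x ∷ xs) f g rewrite ∑-+ xs f g =
  solve 4 (λ a b c d → a :+ b :+ (c :+ d) := a :+ c :+ (b :+ d)) refl (f x) (g x) (∑ xs f) (∑ xs g)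
  where open +-*-Solver

∑-* : ∀ (xs : List A) c f → ∑ xs (λ x → c * f x) ≡ c * ∑ xs f
∑-* []       c f = sym (ℕ.*-zeroʳ c)
∑-* (x ∷ xs) c f rewrite ∑-* xs c f = sym (ℕ.*-distribˡ-+ c (f x) (∑ xs f))

∑-comm : ∀ (xs : List A) (ys : List B) (f : A → B → ℕ) →
  ∑ xs (λ x → ∑ ys (f x)) ≡ ∑ ys (λ y → ∑ xs (λ x → f x y))
∑-comm []       ys f = sym (trans (∑-const ys 0) (ℕ.*-zeroʳ (length ys)))
∑-comm (x ∷ xs) ys f rewrite ∑-comm xs ys f = sym (∑-+ ys (f x) _)

-- The image has no repetitions, as `f` is injective on `xs`, and has the same elements as `xs`.
-- Duplicate-free lists with the same elements are permutations of each other.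
map-involution : ∀ {xs : List A} → Unique xs → (f : A → A) →
  (∀ {x} → x ∈ xs → f x ∈ xs) → (∀ {x} → x ∈ xs → f (f x) ≡ x) →
  map f xs ↭ xs
map-involution {xs = xs} xs! f f∈ ff =
  ∼bag⇒↭ (unique∧set⇒bag (map! xs! ff) xs!
    (mk⇔ ∈-map-f⁻ (λ x∈ → subst (_∈ map f xs) (ff x∈) (∈-map⁺ f (f∈ x∈)))))
  where
  map! : ∀ {ys} → Unique ys → (∀ {x} → x ∈ ys → f (f x) ≡ x) → Unique (map f ys)
  map! [] _ = []
  map! {y ∷ ys} (y∉ys ∷ ys!) ff = All.tabulate fy≢ ∷ map! ys! (ff ∘ there)
    where
    fy≢ : ∀ {z} → z ∈ map f ys → f y ≢ z
    fy≢ z∈ fy≡z with x , x∈ , refl ← ∈-map⁻ f z∈ =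
      All.lookup y∉ys x∈ (trans (sym (ff (here refl))) (trans (cong f fy≡z) (ff (there x∈))))
  ∈-map-f⁻ : ∀ {x} → x ∈ map f xs → x ∈ xs
  ∈-map-f⁻ x∈ with y , y∈ , refl ← ∈-map⁻ f x∈ = f∈ y∈

∑-involution : ∀ {xs : List A} → Unique xs → (f : A → A) →
  (∀ {x} → x ∈ xs → f x ∈ xs) → (∀ {x} → x ∈ xs → f (f x) ≡ x) →
  ∀ h → ∑ xs (h ∘ f) ≡ ∑ xs h
∑-involution {xs = xs} xs! f f∈ ff h =
  trans (cong sum (map-∘ xs)) (sum-↭ (↭.map⁺ h (map-involution xs! f f∈ ff)))

length-filter-⊎ : ∀ {p q r} {P : Pred A p} {Q : Pred A q} {R : Pred A r}
  (P? : Decidable P) (Q? : Decidable Q) (R? : Decidable R) →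
  (∀ {x} → R x → P x ⊎ Q x) → (∀ {x} → P x → R x) → (∀ {x} → Q x → R x) →
  (∀ {x} → P x → ¬ Q x) → ∀ xs →
  length (filter R? xs) ≡ length (filter P? xs) + length (filter Q? xs)
length-filter-⊎ P? Q? R? split P⇒R Q⇒R disj []       = refl
length-filter-⊎ P? Q? R? split P⇒R Q⇒R disj (x ∷ xs)
  with ih ← length-filter-⊎ P? Q? R? split P⇒R Q⇒R disj xs
  with P? x | Q? x | R? x
... | yes px | yes qx | _      = contradiction qx (disj px)
... | yes px | no _   | no ¬rx = contradiction (P⇒R px) ¬rx
... | no _   | yes qx | no ¬rx = contradiction (Q⇒R qx) ¬rx
... | no _   | no _   | no _   = ih
... | yes _  | no _   | yes _  = cong suc ih
... | no _   | yes _  | yes _  = trans (cong suc ih) (sym (ℕ.+-suc _ _))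
... | no ¬px | no ¬qx | yes rx with split rx
...   | inj₁ px = contradiction px ¬px
...   | inj₂ qx = contradiction qx ¬qx

-- Applied to `_≺_` it gives the least key, in `length-largest`; applied to `flip _≺_` the greatest,
-- in `search-bound`.
extremum : {R : Rel A ℓ} → Transitive R → (∀ x y → x ≢ y → R x y ⊎ R y x) →
  ∀ {xs} → Unique xs → 1 ≤ length xs → ∃₂ λ m ys → xs ↭ m ∷ ys × All (R m) ys
extremum R-trans R-total {x ∷ []} _ _ = x , [] , ↭-refl , []
extremum R-trans R-total {x ∷ xs@(_ ∷ _)} (x∉xs ∷ xs!) _
  with extremum R-trans R-total xs! (s≤s z≤n)
... | m , ys , σ , m-least
  with R-total x m (λ x≡m → All.lookup x∉xs (↭.∈-resp-↭ (↭-sym σ) (here refl)) x≡m)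
... | inj₁ xRm = x , m ∷ ys , ↭-prep x σ , xRm ∷ All.map (R-trans xRm) m-least
... | inj₂ mRx = m , x ∷ ys , ↭-trans (↭-prep x σ) (↭-swap x m ↭-refl) , mRx ∷ m-least

-- Transpositions and double counting

module Transposition {A : Set a} (_≟_ : DecidableEquality A) where

  transpose : A → A → A → A
  transpose x y z with z ≟ x | z ≟ y
  ... | yes _ | _     = y
  ... | no _  | yes _ = x
  ... | no _  | no _  = z

  transpose-left : ∀ x y → transpose x y x ≡ y
  transpose-left x y with x ≟ x | x ≟ y
  ... | yes _  | _ = refl
  ... | no x≢x | _ = contradiction refl x≢x

  transpose-right : ∀ x y → transpose x y y ≡ x
  transpose-right x y with y ≟ x | y ≟ y
  ... | yes y≡x | _      = y≡x
  ... | no _    | yes _  = refl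
  ... | no _    | no y≢y = contradiction refl y≢y

  transpose-other : ∀ x y {z} → z ≢ x → z ≢ y → transpose x y z ≡ z
  transpose-other x y {z} z≢x z≢y with z ≟ x | z ≟ y
  ... | yes z≡x | _       = contradiction z≡x z≢x
  ... | no _    | yes z≡y = contradiction z≡y z≢y
  ... | no _    | no _    = refl

  transpose-preserves : ∀ {p} (P : A → Set p) {x y z} → P x → P y → P z → P (transpose x y z)
  transpose-preserves P {x} {y} {z} px py pz with z ≟ x | z ≟ y
  ... | yes _ | _     = py
  ... | no _  | yes _ = px
  ... | no _  | no _  = pz

  transpose-involutive : ∀ x y z → transpose x y (transpose x y z) ≡ z
  transpose-involutive x y z with z ≟ x | z ≟ y
  ... | yes refl | _        = transpose-right x y
  ... | no _     | yes refl = transpose-left x y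
  ... | no z≢x   | no z≢y   = transpose-other x y z≢x z≢y

module Counting {A : Set a} (_≟_ : DecidableEquality A) where
  open DecMembership _≟_ using (_∈?_)

  hits : List A → List A → ℕ
  hits X xs = length (filter (_∈? X) xs)

  occurrences : A → List A → ℕ
  occurrences x xs = length (filter (x ≟_) xs)

  hits-∑ : ∀ {X} → Unique X → ∀ xs → hits X xs ≡ ∑ X (λ x → occurrences x xs)
  hits-∑ {[]}    []          xs = none xs
    where
    none : ∀ xs → hits [] xs ≡ 0
    none []       = refl
    none (x ∷ xs) = none xs
  hits-∑ {x ∷ X} (x∉X ∷ X!) xs =
    trans (length-filter-⊎ (x ≟_) (_∈? X) (_∈? (x ∷ X)) split (here ∘ sym) there disj xs)
          (cong (occurrences x xs +_) (hits-∑ X! xs))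
    where
    split : ∀ {y} → y ∈ x ∷ X → x ≡ y ⊎ y ∈ X
    split (here y≡x)  = inj₁ (sym y≡x)
    split (there y∈X) = inj₂ y∈X
    disj : ∀ {y} → x ≡ y → y ∉ X
    disj refl x∈X = All.lookup x∉X x∈X refl

  occurrences-∈ : ∀ {x xs} → x ∈ xs → 1 ≤ occurrences x xs
  occurrences-∈ {x} {y ∷ xs} x∈ with x ≟ y | x∈
  ... | yes _   | _          = s≤s z≤n
  ... | no x≢y  | here x≡y   = contradiction x≡y x≢y
  ... | no _    | there x∈xs = occurrences-∈ x∈xs

  occurrences-∉ : ∀ {x} xs → x ∉ xs → occurrences x xs ≡ 0
  occurrences-∉ []           _ = refl
  occurrences-∉ {x} (y ∷ xs) x∉ with x ≟ y
  ... | yes x≡y = contradiction (here x≡y) x∉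
  ... | no _    = occurrences-∉ xs (x∉ ∘ there)

  occurrences-↭ : ∀ x {xs ys} → xs ↭ ys → occurrences x xs ≡ occurrences x ys
  occurrences-↭ x σ = ↭.↭-length (↭.filter-↭ (x ≟_) σ)

  occurrences-map : ∀ (g : A → A) → (∀ {x y} → g x ≡ g y → x ≡ y) →
    ∀ x xs → occurrences (g x) (map g xs) ≡ occurrences x xs
  occurrences-map g g-inj x []       = refl
  occurrences-map g g-inj x (y ∷ xs) with x ≟ y | g x ≟ g y
  ... | yes _   | yes _    = cong suc (occurrences-map g g-inj x xs)
  ... | no _    | no _     = occurrences-map g g-inj x xs
  ... | yes x≡y | no gx≢gy = contradiction (cong g x≡y) gx≢gy
  ... | no x≢y  | yes gx≡gy = contradiction (g-inj gx≡gy) x≢y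

  hits-++ : ∀ X xs ys → hits X (xs ++ ys) ≡ hits X xs + hits X ys
  hits-++ X xs ys = trans (cong length (filter-++ (_∈? X) xs ys)) (length-++ (filter (_∈? X) xs))

  length-⊆ : ∀ {xs ys} → Unique xs → (∀ {x} → x ∈ xs → x ∈ ys) → length xs ≤ length ys
  length-⊆ {xs} {ys} xs! xs⊆ys = begin
    length xs                     ≡⟨ ℕ.*-identityʳ (length xs) ⟨
    length xs * 1                 ≡⟨ ∑-const xs 1 ⟨
    ∑ xs (λ _ → 1)                ≤⟨ ∑-mono xs (occurrences-∈ ∘ xs⊆ys) ⟩
    ∑ xs (λ x → occurrences x ys) ≡⟨ hits-∑ xs! ys ⟨
    hits xs ys                    ≤⟨ length-filter (_∈? xs) ys ⟩
    length ys                     ∎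
    where open ℕ.≤-Reasoning

  hits-≤ : ∀ X {xs} → Unique xs → hits X xs ≤ length X
  hits-≤ X {xs} xs! = length-⊆ (Unique.filter⁺ (_∈? X) xs!)
    (λ x∈ → proj₂ (∈-filter⁻ (_∈? X) {xs = xs} x∈))

  -- Double counting: the elements of S have equal shares in the total length
  -- of the lists F q.
  equidistributed : ∀ {b} {B : Set b} (C : List B) (F : B → List A) N {S X} →
    Unique S → Unique X → 1 ≤ length S →
    (∀ {q} → q ∈ C → ∀ {x} → x ∈ F q → x ∈ S) →
    (∀ {q} → q ∈ C → N * length (F q) ≤ length S) →
    (∀ {x y} → x ∈ S → y ∈ S →
      ∑ C (λ q → occurrences x (F q)) ≡ ∑ C (λ q → occurrences y (F q))) →
    N * ∑ C (λ q → hits X (F q)) ≤ length X * length C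
  equidistributed C F N {S@(s ∷ _)} {X} S! X! (s≤s z≤n) F⊆S F-short const = begin
    N * ∑ C (λ q → hits X (F q))                      ≡⟨ cong (N *_) (total X!) ⟩
    N * ∑ X count                                     ≤⟨ ℕ.*-monoʳ-≤ N (∑-mono X λ {x} _ → count≤ x) ⟩
    N * ∑ X (λ _ → c)                                 ≡⟨ cong (N *_) (∑-const X c) ⟩
    N * (length X * c)                                ≡⟨ x∙yz≈y∙xz N (length X) c ⟩
    length X * (N * c)                                ≤⟨ ℕ.*-monoʳ-≤ (length X) Nc≤|C| ⟩
    length X * length C                               ∎
    where
    open ℕ.≤-Reasoning
    open CommutativeSemigroupProperties ℕ.*-commutativeSemigroup using (x∙yz≈y∙xz)
    count : A → ℕ
    count x = ∑ C (λ q → occurrences x (F q))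
    c = count s
    total : ∀ {Y} → Unique Y → ∑ C (λ q → hits Y (F q)) ≡ ∑ Y count
    total {Y} Y! = trans (∑-cong C λ {q} _ → hits-∑ Y! (F q)) (∑-comm C Y _)
    count≤ : ∀ x → count x ≤ c
    count≤ x with x ∈? S
    ... | yes x∈S = ℕ.≤-reflexive (const x∈S (here refl))
    -- Elements of `X` outside `S`, in the application the keys already deleted, occur in no `F q`.
    ... | no  x∉S = ℕ.≤-trans (ℕ.≤-reflexive (trans
          (∑-cong C λ {q} q∈C → occurrences-∉ (F q) (x∉S ∘ F⊆S q∈C))
          (trans (∑-const C 0) (ℕ.*-zeroʳ (length C))))) z≤n
    Nc≤|C| : N * c ≤ length C
    -- All elements of `S` have the count `c`, so `length S * c` is the number of entries from `S`
    -- in all the lists `F q` together, which `F-short` bounds.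
    Nc≤|C| = ℕ.*-cancelˡ-≤ (length S) (begin
      length S * (N * c)               ≡⟨ x∙yz≈y∙xz (length S) N c ⟩
      N * (length S * c)               ≡⟨ cong (N *_) (∑-const S c) ⟨
      N * ∑ S (λ _ → c)                ≡⟨ cong (N *_) (∑-cong S λ x∈S → const (here refl) x∈S) ⟩
      N * ∑ S count                    ≡⟨ cong (N *_) (total S!) ⟨
      N * ∑ C (λ q → hits S (F q))     ≤⟨ ℕ.*-monoʳ-≤ N (∑-mono C λ {q} _ → length-filter (_∈? S) (F q)) ⟩
      N * ∑ C (λ q → length (F q))     ≡⟨ ∑-* C N (length ∘ F) ⟨
      ∑ C (λ q → N * length (F q))     ≤⟨ ∑-mono C F-short ⟩
      ∑ C (λ _ → length S)             ≡⟨ ∑-const C (length S) ⟩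
      length C * length S              ≡⟨ ℕ.*-comm (length C) (length S) ⟩
      length S * length C              ∎)

-- Enumeration of the placements

module _ {K : Set a} where

  treeKeys  : Tree K k → List K
  childKeys : Children K k → List K
  treeKeys (node x ts) = x ∷ childKeys ts
  childKeys []       = []
  childKeys (ts ▹ t) = childKeys ts ++ treeKeys t

  queueKeys : RootList K s → List K
  queueKeys []       = []
  queueKeys (skip q) = queueKeys q
  queueKeys (t ∷ q)  = treeKeys t ++ queueKeys q

  digits : RootList K s → Expansion 2
  digits []       = []
  digits (skip q) = zero ∷ digits q
  digits (t ∷ q)  = suc zero ∷ digits q

  length-treeKeys  : (t : Tree K k) → length (treeKeys t) ≡ 2 ^ k
  length-childKeys : (ts : Children K k) → suc (length (childKeys ts)) ≡ 2 ^ k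
  length-treeKeys (node x ts) = length-childKeys ts
  length-childKeys []       = refl
  length-childKeys {suc k} (ts ▹ t) = begin
    suc (length (childKeys ts ++ treeKeys t))        ≡⟨ cong suc (length-++ (childKeys ts)) ⟩
    suc (length (childKeys ts)) + length (treeKeys t) ≡⟨ cong₂ _+_ (length-childKeys ts) (length-treeKeys t) ⟩
    2 ^ k + 2 ^ k                                    ≡⟨ cong (2 ^ k +_) (ℕ.+-identityʳ (2 ^ k)) ⟨
    2 ^ suc k                                        ∎
    where open ≡-Reasoning

  length-queueKeys : (q : RootList K s) → length (queueKeys q) ≡ fromDigits (digits q) * 2 ^ s
  length-queueKeys []           = refl
  length-queueKeys {s} (skip q) =
    trans (length-queueKeys q) (sym (ℕ.*-assoc (fromDigits (digits q)) 2 (2 ^ s)))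
  length-queueKeys {s} (t ∷ q)
    rewrite length-++ (treeKeys t) {queueKeys q} | length-treeKeys t | length-queueKeys q =
    cong (2 ^ s +_) (sym (ℕ.*-assoc (fromDigits (digits q)) 2 (2 ^ s)))

module _ {K : Set a} where

  record Enumerates {A : Set a} (keysOf : A → List K) (Shape : A → Set)
                    (fill : List K → List (A × List K)) : Set a where
    field
      sound    : ∀ {xs x ys} → (x , ys) ∈ fill xs → Shape x × keysOf x ++ ys ↭ xs
      complete : ∀ {xs x zs} → Shape x → keysOf x ++ zs ↭ xs → ∃[ ys ] (x , ys) ∈ fill xs
      unique   : ∀ {xs} → Unique xs → Unique (map proj₁ (fill xs))

  open Enumerates

  module _ {A B C : Set a} {keysA : A → List K} {keysB : B → List K} {keysC : C → List K}
           {ShapeA : A → Set} {ShapeB : B → Set} {ShapeC : C → Set}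
           {fillA : List K → List (A × List K)} {fillB : List K → List (B × List K)}
           (enumA : Enumerates keysA ShapeA fillA) (enumB : Enumerates keysB ShapeB fillB)
           (con : A → B → C)
           (con-injective : ∀ {a b a′ b′} → con a b ≡ con a′ b′ → a ≡ a′ × b ≡ b′)
           (con-keys : ∀ a b → keysC (con a b) ≡ keysA a ++ keysB b)
           (con-shape : ∀ {a b} → ShapeA a → ShapeB b → ShapeC (con a b))
           (con-view : ∀ {c} → ShapeC c → ∃₂ λ a b → c ≡ con a b × ShapeA a × ShapeB b) where

    private
      step : A × List K → List (C × List K)
      step (a , ys) = concatMap (λ (b , zs) → [ con a b , zs ]) (fillB ys)

      fillC : List K → List (C × List K)
      fillC xs = concatMap step (fillA xs)

      step⁻ : ∀ {a ys c zs} → (c , zs) ∈ step (a , ys) → ∃[ b ] c ≡ con a b × (b , zs) ∈ fillB ys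
      step⁻ {a} {ys} c∈ with find (∈-concatMap⁻ (λ (b , zs) → [ con a b , zs ]) {xs = fillB ys} c∈)
      ... | (b , _) , b∈ , here refl = b , refl , b∈

      sound′ : ∀ {xs c zs} → (c , zs) ∈ fillC xs → ShapeC c × keysC c ++ zs ↭ xs
      sound′ {xs} {c} {zs} c∈ with find (∈-concatMap⁻ step {xs = fillA xs} c∈)
      ... | (a , ys) , a∈ , c∈step with step⁻ c∈step
      ... | b , refl , b∈ with sound enumA a∈ | sound enumB b∈
      ... | a-shape , σ | b-shape , τ = con-shape a-shape b-shape , (begin
        keysC (con a b) ++ zs     ≡⟨ cong (_++ zs) (con-keys a b) ⟩
        (keysA a ++ keysB b) ++ zs ≡⟨ ++-assoc (keysA a) (keysB b) zs ⟩
        keysA a ++ keysB b ++ zs  ↭⟨ ↭.++⁺ˡ (keysA a) τ ⟩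
        keysA a ++ ys             ↭⟨ σ ⟩
        xs                        ∎)
        where open PermutationReasoning

      complete′ : ∀ {xs c zs} → ShapeC c → keysC c ++ zs ↭ xs → ∃[ ys ] (c , ys) ∈ fillC xs
      complete′ {xs} {zs = zs} c-shape σ with con-view c-shape
      ... | a , b , refl , a-shape , b-shape = ws , ∈-concatMap⁺ step (lose a∈ (∈-concatMap⁺ _ (lose b∈ (here refl))))
        where
        σ′ : keysA a ++ keysB b ++ zs ↭ xs
        σ′ = ↭-trans (↭-reflexive (trans (sym (++-assoc (keysA a) (keysB b) zs)) (cong (_++ zs) (sym (con-keys a b))))) σ
        ys = proj₁ (complete enumA a-shape σ′)
        a∈ = proj₂ (complete enumA a-shape σ′)
        cancel : ∀ us {vs ws : List K} → us ++ vs ↭ us ++ ws → vs ↭ ws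
        cancel []       τ = τ
        cancel (u ∷ us) τ = cancel us (↭.drop-∷ τ)
        -- The leftover `ys` of the first stage may list its keys in another order than
        -- `keysB b ++ zs`; cancelling `keysA a` relates them.
        τ : keysB b ++ zs ↭ ys
        τ = cancel (keysA a) (↭-trans σ′ (↭-sym (proj₂ (sound enumA a∈))))
        ws = proj₁ (complete enumB b-shape τ)
        b∈ = proj₂ (complete enumB b-shape τ)

      unique-step : ∀ a (bs : List (B × List K)) → Unique (map proj₁ bs) →
        Unique (map proj₁ (concatMap (λ (b , zs) → [ con a b , zs ]) bs))
      unique-step a bs bs! = subst Unique (map-step bs) (Unique.map⁺ (proj₂ ∘ con-injective) bs!)
        where
        map-step : ∀ bs → map (con a) (map proj₁ bs) ≡ map proj₁ (concatMap (λ (b , zs) → [ con a b , zs ]) bs)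
        map-step []       = refl
        map-step (b ∷ bs) = cong (con a (proj₁ b) ∷_) (map-step bs)

      unique-concat : ∀ (as : List (A × List K)) → Unique (map proj₁ as) →
        (∀ {a ys} → (a , ys) ∈ as → Unique ys) → Unique (map proj₁ (concatMap step as))
      unique-concat []               _           _   = []
      unique-concat ((a , ys) ∷ as) (a∉as ∷ as!) ys! =
        subst Unique (sym (map-++ proj₁ (step (a , ys)) (concatMap step as)))
          (Unique.++⁺ (unique-step a (fillB ys) (unique enumB (ys! (here refl))))
                      (unique-concat as as! (ys! ∘ there)) disjoint)
        where
        disjoint : ∀ {c} → ¬ (c ∈ map proj₁ (step (a , ys)) × c ∈ map proj₁ (concatMap step as))
        disjoint (c∈₁ , c∈₂) with ∈-map⁻ proj₁ c∈₁ | ∈-map⁻ proj₁ c∈₂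
        ... | _ , c∈step , refl | _ , c∈rest , eq with find (∈-concatMap⁻ step {xs = as} c∈rest)
        ... | (a′ , ys′) , a′∈as , c∈step′ with step⁻ c∈step | step⁻ c∈step′
        ... | b , eq₁ , _ | b′ , eq₂ , _ =
          All.lookup a∉as (∈-map⁺ proj₁ a′∈as) (proj₁ (con-injective (trans (sym eq₁) (trans eq eq₂))))

    -- Every composite filling takes a first component from the given keys and a second from the
    -- leftovers. Results with different first components differ by injectivity of `con`; for a
    -- fixed one they differ because the leftovers are again distinct.
    enumerates-bind : Enumerates keysC ShapeC fillC
    enumerates-bind .sound    = sound′
    enumerates-bind .complete = complete′
    enumerates-bind .unique {xs} xs! = unique-concat (fillA xs) (unique enumA xs!)
      (λ {a} a∈ → Unique-++⁻ʳ (keysA a) (Unique-resp-↭ (↭-sym (proj₂ (sound enumA a∈))) xs!))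

  pick-enumerates : Enumerates {A = K} [_] (λ _ → ⊤) pick
  pick-enumerates = record { sound = λ x∈ → tt , pick-sound _ x∈ ; complete = λ _ σ → pick-complete (↭.∈-resp-↭ σ (here refl))
                           ; unique = λ {xs} xs! → subst Unique (sym (map-pick xs)) xs! }
    where
    pick-sound : ∀ xs {x ys} → (x , ys) ∈ pick xs → x ∷ ys ↭ xs
    pick-sound (x ∷ xs) (here refl) = ↭-refl
    pick-sound (x ∷ xs) (there y∈) with ∈-map⁻ (map₂ (x ∷_)) y∈
    ... | (y , ys) , y∈pick , refl = ↭-trans (↭-swap y x ↭-refl) (↭-prep x (pick-sound xs y∈pick))
    pick-complete : ∀ {x xs} → x ∈ xs → ∃[ ys ] (x , ys) ∈ pick xs
    pick-complete (here refl) = _ , here refl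
    pick-complete {xs = y ∷ _} (there x∈) with pick-complete x∈
    ... | ys , x∈pick = y ∷ ys , there (∈-map⁺ (map₂ (y ∷_)) x∈pick)
    map-pick : ∀ xs → map proj₁ (pick xs) ≡ xs
    map-pick []       = refl
    map-pick (x ∷ xs) = cong (x ∷_) (trans (sym (map-∘ (pick xs))) (map-pick xs))

  fillTree-enumerates     : ∀ k → Enumerates {A = Tree K k} treeKeys (λ _ → ⊤) (fillTree k)
  fillChildren-enumerates : ∀ k → Enumerates {A = Children K k} childKeys (λ _ → ⊤) (fillChildren k)
  fillTree-enumerates k = enumerates-bind pick-enumerates (fillChildren-enumerates k)
    node (λ { refl → refl , refl }) (λ _ _ → refl) (λ _ _ → tt) (λ { {node x ts} _ → x , ts , refl , tt , tt })
  fillChildren-enumerates zero = record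
    { sound    = λ { (here refl) → tt , ↭-refl }
    ; complete = λ { {x = []} _ _ → _ , here refl }
    ; unique   = λ _ → [] ∷ [] }
  fillChildren-enumerates (suc k) = enumerates-bind (fillChildren-enumerates k) (fillTree-enumerates k)
    _▹_ (λ { refl → refl , refl }) (λ _ _ → refl) (λ _ _ → tt) (λ { {ts ▹ t} _ → ts , t , refl , tt , tt })

  fillRootList-enumerates : ∀ s ds →
    Enumerates {A = RootList K s} queueKeys (λ q → digits q ≡ ds) (fillRootList s ds)
  fillRootList-enumerates s [] = record
    { sound    = λ { (here refl) → refl , ↭-refl }
    ; complete = λ { {x = []} _ _ → _ , here refl }
    ; unique   = λ _ → [] ∷ [] }
  fillRootList-enumerates s (zero ∷ ds) = record
    { sound    = λ q∈ → sound′ (∈-map⁻ (map₁ skip) q∈)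
    ; complete = λ { {x = skip q} eq σ → map₂ (∈-map⁺ (map₁ skip)) (complete ih (∷-injectiveʳ eq) σ) }
    ; unique   = λ {xs} xs! → subst Unique (trans (sym (map-∘ (fillRootList (suc s) ds xs))) (map-∘ (fillRootList (suc s) ds xs)))
                   (Unique.map⁺ (λ { refl → refl }) (unique ih xs!)) }
    where
    ih = fillRootList-enumerates (suc s) ds
    sound′ : ∀ {q ys xs} → ∃[ p ] p ∈ fillRootList (suc s) ds xs × (q , ys) ≡ map₁ skip p →
             digits q ≡ zero ∷ ds × queueKeys q ++ ys ↭ xs
    sound′ (_ , q∈ , refl) with sound ih q∈
    ... | eq , σ = cong (zero ∷_) eq , σ
  fillRootList-enumerates s (suc zero ∷ ds) = enumerates-bind (fillTree-enumerates s) (fillRootList-enumerates (suc s) ds)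
    RootList._∷_ (λ { refl → refl , refl }) (λ _ _ → refl) (λ _ eq → cong (suc zero ∷_) eq)
    (λ { {t ∷ q} eq → t , q , refl , tt , ∷-injectiveʳ eq ; {[]} () ; {skip _} () })

  digitsOf : List K → Expansion 2
  digitsOf keys = proj₁ (toDigits 2 (length keys))

  -- The digits evaluate to `length keys`, so the nodes use up all keys and the leftover `ys` is
  -- empty.
  placements-sound : ∀ {keys q} → q ∈ placements keys → digits q ≡ digitsOf keys × queueKeys q ↭ keys
  placements-sound {keys} {q} q∈ with ∈-map⁻ proj₁ q∈
  ... | (_ , ys) , q∈fill , refl with sound (fillRootList-enumerates zero (digitsOf keys)) q∈fill
  ... | eq , σ = eq , ↭-trans (↭-reflexive (sym (trans (cong (queueKeys q ++_) ys≡[]) (++-identityʳ (queueKeys q))))) σ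
    where
    lengths : length (queueKeys q) + length ys ≡ length (queueKeys q) + 0
    lengths = begin
      length (queueKeys q) + length ys  ≡⟨ length-++ (queueKeys q) ⟨
      length (queueKeys q ++ ys)        ≡⟨ ↭.↭-length σ ⟩
      length keys                       ≡⟨ proj₂ (toDigits 2 (length keys)) ⟨
      fromDigits (digitsOf keys)        ≡⟨ cong fromDigits eq ⟨
      fromDigits (digits q)             ≡⟨ ℕ.*-identityʳ _ ⟨
      fromDigits (digits q) * 1         ≡⟨ length-queueKeys q ⟨
      length (queueKeys q)              ≡⟨ ℕ.+-identityʳ _ ⟨
      length (queueKeys q) + 0          ∎
      where open ≡-Reasoning
    ys≡[] : ys ≡ []
    ys≡[] = length≡0 (ℕ.+-cancelˡ-≡ (length (queueKeys q)) _ _ lengths)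
      where
      length≡0 : ∀ {xs : List K} → length xs ≡ 0 → xs ≡ []
      length≡0 {[]} _ = refl

  placements-complete : ∀ {keys q} → digits q ≡ digitsOf keys → queueKeys q ↭ keys → q ∈ placements keys
  placements-complete {keys} {q} eq σ = ∈-map⁺ proj₁ (proj₂ (complete (fillRootList-enumerates zero (digitsOf keys)) {zs = []} eq
    (↭-trans (↭-reflexive (++-identityʳ (queueKeys q))) σ)))

  placements-unique : ∀ {keys} → Unique keys → Unique (placements keys)
  placements-unique {keys} = unique (fillRootList-enumerates zero (digitsOf keys))

-- Shape of Root lists

module _ {K : Set a} where

  unfoldChildren : ∀ {k} → Children K k → RootList K k → Queue K
  unfoldChildren []       q = q
  unfoldChildren (ts ▹ t) q = unfoldChildren ts (t ∷ q)

  -- The left-hand side of go≡ is the function go local to childList, which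
  -- cannot be named. Generalising its arguments in childList≡ turns the
  -- constraint for the underscore into one that unification solves.
  mutual
    childList≡ : ∀ {k} x (ts : Children K k) → childList (node x ts) ≡ unfoldChildren ts []
    childList≡ x []       = refl
    childList≡ {suc k} x (ts ▹ t) with suc k | ts ▹ t | RootList._∷_ t []
    ... | _ | us | q = go≡ x us ts q

    go≡ : ∀ {j k} (x : K) (us : Children K j) (ts : Children K k) (q : RootList K k) →
          _≡_ {A = Queue K} _ (unfoldChildren ts q)
    go≡ x us []       q = refl
    go≡ x us (ts ▹ t) q = go≡ x us ts (t ∷ q)

  children : Tree K k → Children K k
  children (node _ ts) = ts

  root∈treeKeys : (t : Tree K k) → root t ∈ treeKeys t
  root∈treeKeys (node _ _) = here refl

  childList-keys : ∀ x (ts : Children K k) → queueKeys (childList (node x ts)) ↭ childKeys ts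
  childList-keys x ts rewrite childList≡ x ts = ↭-trans (unfold-keys ts []) (↭-reflexive (++-identityʳ (childKeys ts)))
    where
    unfold-keys : ∀ {k} (ts : Children K k) q → queueKeys (unfoldChildren ts q) ↭ childKeys ts ++ queueKeys q
    unfold-keys []       q = ↭-refl
    unfold-keys (ts ▹ t) q = ↭-trans (unfold-keys ts (t ∷ q))
      (↭-reflexive (sym (++-assoc (childKeys ts) (treeKeys t) (queueKeys q))))

  -- Trees come in order of increasing size, so the k largest are left out.
  small : ℕ → RootList K s → List K
  small k []       = []
  small k (skip q) = small k q
  small k (t ∷ q) with k ℕ.≤? length (rootKeys q)
  ... | yes _ = treeKeys t ++ small k q
  ... | no  _ = []

  small⊆queueKeys : ∀ k (q : RootList K s) {x} → x ∈ small k q → x ∈ queueKeys q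
  small⊆queueKeys k (skip q) x∈ = small⊆queueKeys k q x∈
  small⊆queueKeys k (t ∷ q)  x∈ with k ℕ.≤? length (rootKeys q)
  ... | yes _ with ∈-++⁻ (treeKeys t) x∈
  ...   | inj₁ x∈t = ∈-++⁺ˡ x∈t
  ...   | inj₂ x∈q = ∈-++⁺ʳ (treeKeys t) (small⊆queueKeys k q x∈q)

  -- Adding 2ˢ to both sizes amounts to the worst case, in which every smaller
  -- tree is present.
  length-small+2ˢ : ∀ k (q : RootList K s) → k ≤ length (rootKeys q) →
    2 ^ k * (length (small k q) + 2 ^ s) ≤ length (queueKeys q) + 2 ^ s
  length-small+2ˢ {s} .zero [] z≤n = ℕ.≤-reflexive (ℕ.*-identityˡ (2 ^ s))
  length-small+2ˢ {s} k (skip q) k≤ = ℕ.+-cancelʳ-≤ (2 ^ s) _ _ (begin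
    2 ^ k * (l + 2 ^ s) + 2 ^ s
      ≤⟨ ℕ.+-monoʳ-≤ (2 ^ k * (l + 2 ^ s)) (ℕ.m≤n*m (2 ^ s) (2 ^ k) {{ℕ.>-nonZero (ℕ.m^n>0 2 k)}}) ⟩
    2 ^ k * (l + 2 ^ s) + 2 ^ k * 2 ^ s
      ≡⟨ solve 3 (λ n l w → n :* (l :+ w) :+ n :* w := n :* (l :+ (w :+ (w :+ con 0)))) refl (2 ^ k) l (2 ^ s) ⟩
    2 ^ k * (l + 2 ^ suc s)                ≤⟨ length-small+2ˢ k q k≤ ⟩
    length (queueKeys q) + 2 ^ suc s
      ≡⟨ solve 2 (λ l w → l :+ (w :+ (w :+ con 0)) := l :+ w :+ w) refl (length (queueKeys q)) (2 ^ s) ⟩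
    length (queueKeys q) + 2 ^ s + 2 ^ s   ∎)
    where
    open ℕ.≤-Reasoning
    open +-*-Solver
    l = length (small k q)
  length-small+2ˢ {s} k (t ∷ q) k≤ with k ℕ.≤? length (rootKeys q)
  ... | yes k≤q rewrite length-++ (treeKeys t) {small k q} | length-++ (treeKeys t) {queueKeys q} | length-treeKeys t = begin
    2 ^ k * (2 ^ s + l + 2 ^ s)             ≡⟨ cong (2 ^ k *_) (move (2 ^ s) l) ⟩
    2 ^ k * (l + 2 ^ suc s)                 ≤⟨ length-small+2ˢ k q k≤q ⟩
    length (queueKeys q) + 2 ^ suc s        ≡⟨ move (2 ^ s) (length (queueKeys q)) ⟨
    2 ^ s + length (queueKeys q) + 2 ^ s    ∎
    where
    open ℕ.≤-Reasoning
    open +-*-Solver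
    l = length (small k q)
    move : ∀ w l → w + l + w ≡ l + (w + (w + 0))
    move = solve 2 (λ w l → w :+ l :+ w := l :+ (w :+ (w :+ con 0))) refl
  length-small+2ˢ {s} zero    (t ∷ q) k≤ | no 0≰ = contradiction z≤n 0≰
  -- Here `t` is itself one of the `suc k` largest trees and nothing is small. What remains is a
  -- lower bound on the total size, which follows from the bound for `q` with `k` trees left out.
  length-small+2ˢ {s} (suc k) (t ∷ q) (s≤s k≤) | no _ rewrite length-++ (treeKeys t) {queueKeys q} | length-treeKeys t = begin
    2 ^ suc k * 2 ^ s
      ≡⟨ solve 2 (λ n w → (n :+ (n :+ con 0)) :* w := n :* (w :+ (w :+ con 0))) refl (2 ^ k) (2 ^ s) ⟩
    2 ^ k * 2 ^ suc s
      ≤⟨ ℕ.*-monoʳ-≤ (2 ^ k) (ℕ.m≤n+m (2 ^ suc s) (length (small k q))) ⟩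
    2 ^ k * (length (small k q) + 2 ^ suc s)            ≤⟨ length-small+2ˢ k q k≤ ⟩
    length (queueKeys q) + 2 ^ suc s
      ≡⟨ solve 2 (λ w l → w :+ l :+ w := l :+ (w :+ (w :+ con 0))) refl (2 ^ s) (length (queueKeys q)) ⟨
    2 ^ s + length (queueKeys q) + 2 ^ s                ∎
    where
    open ℕ.≤-Reasoning
    open +-*-Solver

  small-all : ∀ k (q : RootList K s) → length (rootKeys q) < k → small k q ≡ []
  small-all k []       _ = refl
  small-all k (skip q) n<k = small-all k q n<k
  small-all k (t ∷ q)  n<k with k ℕ.≤? length (rootKeys q)
  ... | yes k≤ = contradiction (ℕ.≤-trans (ℕ.n≤1+n _) n<k) (ℕ.≤⇒≯ k≤)
  ... | no  _  = refl

  length-small : ∀ k (q : RootList K s) → 2 ^ k * length (small k q) ≤ length (queueKeys q)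
  length-small {s} k q with k ℕ.≤? length (rootKeys q)
  ... | no k≰ rewrite small-all k q (ℕ.≰⇒> k≰) | ℕ.*-zeroʳ (2 ^ k) = z≤n
  ... | yes k≤ = ℕ.+-cancelʳ-≤ (2 ^ s) _ _ (begin
    2 ^ k * l + 2 ^ s
      ≤⟨ ℕ.+-monoʳ-≤ (2 ^ k * l) (ℕ.m≤n*m (2 ^ s) (2 ^ k) {{ℕ.>-nonZero (ℕ.m^n>0 2 k)}}) ⟩
    2 ^ k * l + 2 ^ k * 2 ^ s    ≡⟨ ℕ.*-distribˡ-+ (2 ^ k) l (2 ^ s) ⟨
    2 ^ k * (l + 2 ^ s)          ≤⟨ length-small+2ˢ k q k≤ ⟩
    length (queueKeys q) + 2 ^ s ∎)
    where
    open ℕ.≤-Reasoning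
    l = length (small k q)

-- Symmetry of heaps and expected number of comparisons

module _ {K : Set a} {_≺_ : Rel K ℓ} (isSTO : IsStrictTotalOrder _≡_ _≺_) where

  open BinomialHeap isSTO
  open IsStrictTotalOrder isSTO using (_≟_; compare; irrefl; asym) renaming (_<?_ to _≺?_; trans to ≺-trans)
  open DecMembership _≟_ using (_∈?_)
  open Counting _≟_
  open Transposition _≟_
  open CommutativeMonoidSolver (↭.++-commutativeMonoid {A = K}) using (_⊜_; _⊕_) renaming (solve to solve-↭)

  join-keys : (t u : Tree K k) → treeKeys (join t u) ↭ treeKeys t ++ treeKeys u
  join-keys t@(node x ts) u@(node y us) with x ≺? y
  ... | yes _ = ↭.++-comm (treeKeys u) (treeKeys t)
  ... | no  _ = ↭-refl

  addCarry-keys : (c : Tree K s) (q : RootList K s) →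
    queueKeys (addCarry c q) ↭ treeKeys c ++ queueKeys q
  addCarry-keys c []       = ↭-refl
  addCarry-keys c (skip q) = ↭-refl
  addCarry-keys c (u ∷ q)  = begin
    queueKeys (addCarry (join c u) q)        ↭⟨ addCarry-keys (join c u) q ⟩
    treeKeys (join c u) ++ queueKeys q       ↭⟨ ↭.++⁺ʳ (queueKeys q) (join-keys c u) ⟩
    (treeKeys c ++ treeKeys u) ++ queueKeys q ≡⟨ ++-assoc (treeKeys c) (treeKeys u) (queueKeys q) ⟩
    treeKeys c ++ treeKeys u ++ queueKeys q  ∎
    where open PermutationReasoning

  merge-keys      : (p q : RootList K s) → queueKeys (merge p q) ↭ queueKeys p ++ queueKeys q
  mergeCarry-keys : (c : Tree K s) (p q : RootList K s) →
    queueKeys (mergeCarry c p q) ↭ treeKeys c ++ queueKeys p ++ queueKeys q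

  mergeJoin-keys : (t u : Tree K s) (p q : RootList K (suc s)) →
    queueKeys (mergeCarry (join t u) p q) ↭ (treeKeys t ++ treeKeys u) ++ queueKeys p ++ queueKeys q
  mergeJoin-keys t u p q = ↭-trans (mergeCarry-keys (join t u) p q) (↭.++⁺ʳ _ (join-keys t u))

  merge-keys []       q        = ↭-refl
  merge-keys (skip p) []       = ↭-sym (↭.++-identityʳ _)
  merge-keys (t ∷ p)  []       = ↭-sym (↭.++-identityʳ _)
  merge-keys (skip p) (skip q) = merge-keys p q
  merge-keys (skip p) (u ∷ q)  = ↭-trans (↭.++⁺ˡ (treeKeys u) (merge-keys p q))
    (↭.shifts (treeKeys u) (queueKeys p))
  merge-keys (t ∷ p)  (skip q) = ↭-trans (↭.++⁺ˡ (treeKeys t) (merge-keys p q))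
    (↭-sym (↭.++-assoc (treeKeys t) (queueKeys p) (queueKeys q)))
  merge-keys (t ∷ p)  (u ∷ q)  = ↭-trans (mergeJoin-keys t u p q)
    (solve-↭ 4 (λ t u p q → (t ⊕ u) ⊕ (p ⊕ q) ⊜ (t ⊕ p) ⊕ (u ⊕ q)) ↭-refl
             (treeKeys t) (treeKeys u) (queueKeys p) (queueKeys q))

  mergeCarry-keys c []       q        = addCarry-keys c q
  mergeCarry-keys c (skip p) []       = ↭.++⁺ˡ (treeKeys c) (↭-sym (↭.++-identityʳ (queueKeys p)))
  mergeCarry-keys c (t ∷ p)  []       = ↭-trans (addCarry-keys c (t ∷ p))
    (↭.++⁺ˡ (treeKeys c) (↭-sym (↭.++-identityʳ (queueKeys (t ∷ p)))))
  mergeCarry-keys c (skip p) (skip q) = ↭.++⁺ˡ (treeKeys c) (merge-keys p q)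
  mergeCarry-keys c (skip p) (u ∷ q)  = ↭-trans (mergeJoin-keys c u p q)
    (solve-↭ 4 (λ c u p q → (c ⊕ u) ⊕ (p ⊕ q) ⊜ c ⊕ (p ⊕ (u ⊕ q))) ↭-refl
             (treeKeys c) (treeKeys u) (queueKeys p) (queueKeys q))
  mergeCarry-keys c (t ∷ p)  (skip q) = ↭-trans (mergeJoin-keys c t p q)
    (solve-↭ 4 (λ c t p q → (c ⊕ t) ⊕ (p ⊕ q) ⊜ c ⊕ ((t ⊕ p) ⊕ q)) ↭-refl
             (treeKeys c) (treeKeys t) (queueKeys p) (queueKeys q))
  mergeCarry-keys c (t ∷ p)  (u ∷ q)  = ↭-trans (↭.++⁺ˡ (treeKeys c) (mergeJoin-keys t u p q))
    (solve-↭ 5 (λ c t u p q → c ⊕ ((t ⊕ u) ⊕ (p ⊕ q)) ⊜ c ⊕ ((t ⊕ p) ⊕ (u ⊕ q))) ↭-refl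
             (treeKeys c) (treeKeys t) (treeKeys u) (queueKeys p) (queueKeys q))

  join-left : (t u : Tree K k) → ¬ (root t ≺ root u) → join t u ≡ node (root t) (children t ▹ u)
  join-left (node x ts) (node y us) x⊀y with x ≺? y
  ... | yes x≺y = contradiction x≺y x⊀y
  ... | no  _   = refl

  join-right : (t u : Tree K k) → root t ≺ root u → join t u ≡ node (root u) (children u ▹ t)
  join-right (node x ts) (node y us) x≺y with x ≺? y
  ... | yes _   = refl
  ... | no  x⊀y = contradiction x≺y x⊀y

  join-root : ∀ {p} (P : K → Set p) (t u : Tree K k) → P (root t) → P (root u) → P (root (join t u))
  join-root P (node x ts) (node y us) px py with x ≺? y
  ... | yes _ = py
  ... | no  _ = px

  join-comm : (t u : Tree K k) → root t ≢ root u → join t u ≡ join u t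
  join-comm t u x≢y = by (compare (root t) (root u))
    where
    by : Tri (root t ≺ root u) (root t ≡ root u) (root u ≺ root t) → join t u ≡ join u t
    by (tri< x≺y _ _) = trans (join-right t u x≺y) (sym (join-left u t (asym x≺y)))
    by (tri≈ _ x≡y _) = contradiction x≡y x≢y
    by (tri> _ _ y≺x) = trans (join-left t u (asym y≺x)) (sym (join-right u t y≺x))

  join-ordered : {t u : Tree K k} → HeapOrdered t → HeapOrdered u → root t ≢ root u → HeapOrdered (join t u)
  join-ordered {t = t@(node x ts)} {u@(node y us)} (node h) (node h′) x≢y with compare x y
  ... | tri< x≺y _ _ = node (h′ ▹ (x≺y , node h))
  ... | tri≈ _ x≡y _ = contradiction x≡y x≢y
  ... | tri> _ _ y≺x = node (h ▹ (y≺x , node h′))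

  -- t and t′ are results of the same knockout tournament, played with some
  -- keys and with their images under g.
  data Linked (g : K → K) : Tree K k → Tree K k → Set a where
    leaf : ∀ x → Linked g (node x []) (node (g x) [])
    match : ∀ {t t′ u u′ : Tree K k} → Linked g t t′ → Linked g u u′ →
            Linked g (join t u) (join t′ u′)

  data LinkedChildren (g : K → K) : Children K k → Children K k → Set a where
    []  : LinkedChildren g [] []
    _▹_ : ∀ {ts ts′ : Children K k} {t t′} → LinkedChildren g ts ts′ → Linked g t t′ →
          LinkedChildren g (ts ▹ t) (ts′ ▹ t′)

  data LinkedQueues (g : K → K) : RootList K s → RootList K s → Set a where
    []   : LinkedQueues g {s} [] []
    skip : {q q′ : RootList K (suc s)} → LinkedQueues g q q′ → LinkedQueues g (skip q) (skip q′)
    _∷_  : {t t′ : Tree K s} {q q′ : RootList K (suc s)} →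
           Linked g t t′ → LinkedQueues g q q′ → LinkedQueues g (t ∷ q) (t′ ∷ q′)

  module _ {g : K → K} where

    linked-keys : {t t′ : Tree K k} → Linked g t t′ → treeKeys t′ ↭ map g (treeKeys t)
    linked-keys (leaf x) = ↭-refl
    linked-keys (match {t = t} {t′} {u} {u′} l m) = begin
      treeKeys (join t′ u′)                  ↭⟨ join-keys t′ u′ ⟩
      treeKeys t′ ++ treeKeys u′             ↭⟨ ↭.++⁺ (linked-keys l) (linked-keys m) ⟩
      map g (treeKeys t) ++ map g (treeKeys u) ≡⟨ map-++ g (treeKeys t) (treeKeys u) ⟨
      map g (treeKeys t ++ treeKeys u)       ↭⟨ ↭.map⁺ g (join-keys t u) ⟨
      map g (treeKeys (join t u))            ∎
      where open PermutationReasoning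

    linkedQueues-keys : {q q′ : RootList K s} → LinkedQueues g q q′ → queueKeys q′ ↭ map g (queueKeys q)
    linkedQueues-keys []       = ↭-refl
    linkedQueues-keys (skip l) = linkedQueues-keys l
    linkedQueues-keys (_∷_ {t = t} {q = q} l m) = ↭-trans (↭.++⁺ (linked-keys l) (linkedQueues-keys m))
      (↭-reflexive (sym (map-++ g (treeKeys t) (queueKeys q))))

    linkedQueues-digits : {q q′ : RootList K s} → LinkedQueues g q q′ → digits q ≡ digits q′
    linkedQueues-digits []       = refl
    linkedQueues-digits (skip l) = cong (_ ∷_) (linkedQueues-digits l)
    linkedQueues-digits (_ ∷ l)  = cong (_ ∷_) (linkedQueues-digits l)

    linkedQueues-length : {q q′ : RootList K s} → LinkedQueues g q q′ →
      length (rootKeys q) ≡ length (rootKeys q′)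
    linkedQueues-length []       = refl
    linkedQueues-length (skip l) = linkedQueues-length l
    linkedQueues-length (_ ∷ l)  = cong suc (linkedQueues-length l)

    -- `small` collects whole trees, selected by their position alone. Linked trees carry
    -- corresponding keys, though possibly at different nodes; hence a permutation.
    linkedQueues-small : ∀ k {q q′ : RootList K s} → LinkedQueues g q q′ →
      small k q′ ↭ map g (small k q)
    linkedQueues-small k []       = ↭-refl
    linkedQueues-small k (skip l) = linkedQueues-small k l
    linkedQueues-small k (_∷_ {t = t} {q = q} {q′} l m)
      with k ℕ.≤? length (rootKeys q) | k ℕ.≤? length (rootKeys q′)
    ... | yes _ | yes _ = ↭-trans (↭.++⁺ (linked-keys l) (linkedQueues-small k m))
      (↭-reflexive (sym (map-++ g (treeKeys t) (small k q))))
    ... | no _  | no _  = ↭-refl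
    ... | yes k≤ | no k≰ = contradiction (subst (k ≤_) (linkedQueues-length m) k≤) k≰
    ... | no k≰ | yes k≤ = contradiction (subst (k ≤_) (sym (linkedQueues-length m)) k≤) k≰

    addCarry-linked : {c c′ : Tree K s} {q q′ : RootList K s} → Linked g c c′ →
      LinkedQueues g q q′ → LinkedQueues g (addCarry c q) (addCarry c′ q′)
    addCarry-linked c []       = c ∷ []
    addCarry-linked c (skip q) = c ∷ q
    addCarry-linked c (u ∷ q)  = skip (addCarry-linked (match c u) q)

    -- Merging looks at keys only inside `join`, which `match` absorbs, so the clauses copy those of
    -- `merge`.
    merge-linked : {p p′ q q′ : RootList K s} → LinkedQueues g p p′ → LinkedQueues g q q′ →
      LinkedQueues g (merge p q) (merge p′ q′)
    mergeCarry-linked : {c c′ : Tree K s} {p p′ q q′ : RootList K s} → Linked g c c′ →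
      LinkedQueues g p p′ → LinkedQueues g q q′ →
      LinkedQueues g (mergeCarry c p q) (mergeCarry c′ p′ q′)

    merge-linked []       q        = q
    merge-linked (skip p) []       = skip p
    merge-linked (t ∷ p)  []       = t ∷ p
    merge-linked (skip p) (skip q) = skip (merge-linked p q)
    merge-linked (skip p) (u ∷ q)  = u ∷ merge-linked p q
    merge-linked (t ∷ p)  (skip q) = t ∷ merge-linked p q
    merge-linked (t ∷ p)  (u ∷ q)  = skip (mergeCarry-linked (match t u) p q)

    mergeCarry-linked c []       q        = addCarry-linked c q
    mergeCarry-linked c (skip p) []       = addCarry-linked c (skip p)
    mergeCarry-linked c (t ∷ p)  []       = addCarry-linked c (t ∷ p)
    mergeCarry-linked c (skip p) (skip q) = c ∷ merge-linked p q
    mergeCarry-linked c (skip p) (u ∷ q)  = skip (mergeCarry-linked (match c u) p q)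
    mergeCarry-linked c (t ∷ p)  (skip q) = skip (mergeCarry-linked (match c t) p q)
    mergeCarry-linked c (t ∷ p)  (u ∷ q)  = c ∷ mergeCarry-linked (match t u) p q

    childList-linked : ∀ {x x′} {ts ts′ : Children K k} → LinkedChildren g ts ts′ →
      LinkedQueues g (childList (node x ts)) (childList (node x′ ts′))
    childList-linked {x = x} {x′} {ts} {ts′} l rewrite childList≡ x ts | childList≡ x′ ts′ = unfold-linked l []
      where
      unfold-linked : ∀ {k} {ts ts′ : Children K k} {q q′} → LinkedChildren g ts ts′ → LinkedQueues g q q′ →
        LinkedQueues g (unfoldChildren ts q) (unfoldChildren ts′ q′)
      unfold-linked []       q = q
      unfold-linked (ts ▹ t) q = unfold-linked ts (t ∷ q)

  -- Deletion of the maximum from linked queues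

  _≼_ : K → K → Set (a ⊔ ℓ)
  x ≼ y = x ≺ y ⊎ x ≡ y

  module _ {g : K → K} {m : K} (gm≡m : g m ≡ m) (g≺m : ∀ {x} → x ≺ m → g x ≺ m) where

    HasRoot : Tree K k → Tree K k → Set a
    HasRoot t t′ = root t ≡ m × root t′ ≡ m × LinkedChildren g (children t) (children t′)

    -- As `g` fixes `m` and keeps smaller keys below it, `m` wins the same matches in both
    -- tournaments. Its children are the opponents it has beaten, one per round, and these are
    -- linked in pairs. A tournament without `m` has no `m` at the top on either side.
    linked-root : {t t′ : Tree K k} → Linked g t t′ → All (_≼ m) (treeKeys t) →
      HasRoot t t′ ⊎ All (_≺ m) (treeKeys t) × root t′ ≺ m
    linked-root (leaf x) (inj₁ x≺m ∷ []) = inj₂ ((x≺m ∷ []) , g≺m x≺m)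
    linked-root (leaf x) (inj₂ refl ∷ []) = inj₁ (refl , gm≡m , [])
    linked-root (match {t = t} {t′} {u} {u′} l l′) ≼m
      with ≼m₁ , ≼m₂ ← All.++⁻ (treeKeys t) (↭.All-resp-↭ (join-keys t u) ≼m)
      with linked-root l ≼m₁ | linked-root l′ ≼m₂
    -- If both roots equal `m`, then `join` keeps its first argument on top on both sides.
    ... | inj₁ (refl , eq , ls) | inj₁ (u≡m , u′≡m , _)
      rewrite join-left t u (irrefl (sym u≡m)) | join-left t′ u′ (irrefl (trans eq (sym u′≡m))) =
      inj₁ (refl , eq , ls ▹ l′)
    ... | inj₁ (refl , eq , ls) | inj₂ (u≺m , u′≺m)
      rewrite join-left t u (asym (All.lookup u≺m (root∈treeKeys u)))
            | join-left t′ u′ (λ t′≺u′ → asym u′≺m (subst (_≺ root u′) eq t′≺u′)) =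
      inj₁ (refl , eq , ls ▹ l′)
    ... | inj₂ (t≺m , t′≺m) | inj₁ (refl , eq , ls)
      rewrite join-right t u (All.lookup t≺m (root∈treeKeys t))
            | join-right t′ u′ (subst (root t′ ≺_) (sym eq) t′≺m) =
      inj₁ (refl , eq , ls ▹ l)
    ... | inj₂ (t≺m , t′≺m) | inj₂ (u≺m , u′≺m) =
      inj₂ (↭.All-resp-↭ (↭-sym (join-keys t u)) (All.++⁺ t≺m u≺m) ,
            join-root (_≺ m) t′ u′ t′≺m u′≺m)

    -- By `linked-root`, `m` is the root of a tree exactly if it is the root of the linked tree, so
    -- both extractions stop at the same position.
    extract-linked : {q q′ : RootList K s} → LinkedQueues g q q′ → All (_≼ m) (queueKeys q) →
      LinkedQueues g (proj₁ (extract m q)) (proj₁ (extract m q′)) ×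
      LinkedQueues g (proj₂ (extract m q)) (proj₂ (extract m q′))
    extract-linked []       _  = [] , []
    extract-linked (skip l) ≼m = map₁ skip (extract-linked l ≼m)
    extract-linked (_∷_ {t = node x ts} {node x′ ts′} l ls) ≼m
      with ≼m₁ , ≼m₂ ← All.++⁻ (x ∷ childKeys ts) ≼m
      with x ≟ m | x′ ≟ m | linked-root l ≼m₁
    ... | yes _    | yes _    | inj₁ (_ , _ , cs)        = skip ls , childList-linked {x = x} {x′} cs
    ... | no _     | no _     | _                        = map₁ (l ∷_) (extract-linked ls ≼m₂)
    ... | yes refl | _        | inj₂ (x≺m ∷ _ , _)       = contradiction x≺m (irrefl refl)
    ... | _        | yes refl | inj₂ (_ , x′≺m)          = contradiction x′≺m (irrefl refl)
    ... | no x≢m   | yes _    | inj₁ (x≡m , _)           = contradiction x≡m x≢m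
    ... | yes _    | no x′≢m  | inj₁ (_ , x′≡m , _)      = contradiction x′≡m x′≢m

    max-root : {q q′ : RootList K s} → LinkedQueues g q q′ → All (_≼ m) (queueKeys q) →
      m ∈ queueKeys q → m ∈ rootKeys q × m ∈ rootKeys q′
    max-root (skip l) ≼m m∈ = max-root l ≼m m∈
    max-root (_∷_ {t = t} l ls) ≼m m∈
      with ≼m₁ , ≼m₂ ← All.++⁻ (treeKeys t) ≼m
      with linked-root l ≼m₁ | ∈-++⁻ (treeKeys t) m∈
    ... | inj₁ (t≡m , t′≡m , _) | _           = here (sym t≡m) , here (sym t′≡m)
    ... | inj₂ (t≺m , _)        | inj₁ m∈t    = contradiction (All.lookup t≺m m∈t) (irrefl refl)
    ... | inj₂ _                | inj₂ m∈q    with max-root ls ≼m₂ m∈q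
    ...   | m∈ , m∈′ = there m∈ , there m∈′

  extract-keys : ∀ {m} (q : RootList K s) → m ∈ rootKeys q →
    m ∷ queueKeys (proj₂ (extract m q)) ++ queueKeys (proj₁ (extract m q)) ↭ queueKeys q
  extract-keys (skip q) m∈ = extract-keys q m∈
  extract-keys {m = m} (node x ts ∷ q) m∈ with x ≟ m | m∈
  ... | yes refl | _        = ↭-prep x (↭.++⁺ʳ (queueKeys q) (childList-keys x ts))
  ... | no x≢m   | here m≡x = contradiction (sym m≡x) x≢m
  ... | no _     | there m∈q = ↭-trans
    (solve-↭ 4 (λ m c t r → m ⊕ (c ⊕ (t ⊕ r)) ⊜ t ⊕ (m ⊕ (c ⊕ r))) ↭-refl
             [ m ] (queueKeys (proj₂ (extract m q))) (x ∷ childKeys ts) (queueKeys (proj₁ (extract m q))))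
    (↭.++⁺ˡ (x ∷ childKeys ts) (extract-keys q m∈q))

  scan-max : ∀ {m} x xs → All (_≼ m) (x ∷ xs) → m ∈ x ∷ xs → proj₁ (scan x xs) ≡ m
  scan-max x []       _                    (here refl) = refl
  scan-max {m} x (y ∷ ys) (x≼m ∷ y≼m ∷ ys≼m) m∈ with x ≺? y
  ... | yes x≺y = scan-max y ys (y≼m ∷ ys≼m) (drop-x m∈ x≺y y≼m)
    where
    drop-x : m ∈ x ∷ y ∷ ys → x ≺ y → y ≼ m → m ∈ y ∷ ys
    drop-x (here refl) x≺y (inj₁ y≺x)  = contradiction y≺x (asym x≺y)
    drop-x (here refl) x≺y (inj₂ refl) = contradiction x≺y (irrefl refl)
    drop-x (there m∈)  _   _           = m∈
  ... | no x⊀y = scan-max x ys (x≼m ∷ ys≼m) (drop-y m∈ x≼m)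
    where
    drop-y : m ∈ x ∷ y ∷ ys → x ≼ m → m ∈ x ∷ ys
    drop-y (here m≡x)          _          = here m≡x
    drop-y (there (here refl)) (inj₁ x≺y) = contradiction x≺y x⊀y
    drop-y (there (here refl)) (inj₂ x≡y) = here (sym x≡y)
    drop-y (there (there m∈))  _          = there m∈

  deleteMax-max : ∀ {m} (q : Queue K) → All (_≼ m) (rootKeys q) → m ∈ rootKeys q →
    proj₁ (deleteMax q) ≡ merge (proj₂ (extract m q)) (proj₁ (extract m q))
  deleteMax-max q ≼m m∈ with rootKeys q
  ... | x ∷ xs with refl ← scan-max x xs ≼m m∈ = refl

  rootKeys⊆queueKeys : (q : RootList K s) → ∀ {x} → x ∈ rootKeys q → x ∈ queueKeys q
  rootKeys⊆queueKeys (skip q) x∈          = rootKeys⊆queueKeys q x∈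
  rootKeys⊆queueKeys (t ∷ q)  (here refl) = ∈-++⁺ˡ (root∈treeKeys t)
  rootKeys⊆queueKeys (t ∷ q)  (there x∈)  = ∈-++⁺ʳ (treeKeys t) (rootKeys⊆queueKeys q x∈)

  deleteMax-keys : ∀ {m} (q : Queue K) → All (_≼ m) (queueKeys q) → m ∈ rootKeys q →
    m ∷ queueKeys (proj₁ (deleteMax q)) ↭ queueKeys q
  deleteMax-keys {m} q ≼m m∈
    rewrite deleteMax-max q (All.tabulate (All.lookup ≼m ∘ rootKeys⊆queueKeys q)) m∈ =
    ↭-trans (↭-prep m (merge-keys (proj₂ (extract m q)) (proj₁ (extract m q)))) (extract-keys q m∈)

  deleteMax-linked : ∀ {g m} → g m ≡ m → (∀ {x} → x ≺ m → g x ≺ m) →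
    {q q′ : Queue K} → LinkedQueues g q q′ →
    All (_≼ m) (queueKeys q) → All (_≼ m) (queueKeys q′) → m ∈ queueKeys q →
    LinkedQueues g (proj₁ (deleteMax q)) (proj₁ (deleteMax q′))
  deleteMax-linked gm≡m g≺m {q} {q′} l ≼m ≼m′ m∈
    with m∈q , m∈q′ ← max-root gm≡m g≺m l ≼m m∈
    rewrite deleteMax-max q (All.tabulate (All.lookup ≼m ∘ rootKeys⊆queueKeys q)) m∈q
          | deleteMax-max q′ (All.tabulate (All.lookup ≼m′ ∘ rootKeys⊆queueKeys q′)) m∈q′
    with rest , cs ← extract-linked gm≡m g≺m l ≼m = merge-linked cs rest

  -- Replaying the tournaments of a configuration

  replay         : (K → K) → Tree K k → Tree K k
  -- The children of a root are its opponents in the order of the rounds, so a heap-ordered tree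
  -- determines its tournament; here it is played again with the keys relabelled by `g`.
  replayChildren : (K → K) → K → Children K k → Tree K k
  replay g (node x ts) = replayChildren g x ts
  replayChildren g x []       = node (g x) []
  replayChildren g x (ts ▹ t) = join (replayChildren g x ts) (replay g t)

  replayQueue : (K → K) → RootList K s → RootList K s
  replayQueue g []       = []
  replayQueue g (skip q) = skip (replayQueue g q)
  replayQueue g (t ∷ q)  = replay g t ∷ replayQueue g q

  module _ (g : K → K) where

    replay-linked : {t : Tree K k} → HeapOrdered t → Linked g t (replay g t)
    replayChildren-linked : ∀ {x} {ts : Children K k} → HeapOrderedBelow x ts →
      Linked g (node x ts) (replayChildren g x ts)
    replay-linked (node h) = replayChildren-linked h
    replayChildren-linked [] = leaf _
    replayChildren-linked (_▹_ {ts = ts} {t} hs (t≺x , h)) =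
      -- Heap order makes the given tree the outcome of a match of `node x ts` against `t`.
      subst (λ u → Linked g u (replayChildren g _ (ts ▹ t))) (join-left (node _ ts) t (asym t≺x))
            (match (replayChildren-linked hs) (replay-linked h))

    replayQueue-linked : {q : RootList K s} → AllHeapOrdered q → LinkedQueues g q (replayQueue g q)
    replayQueue-linked []       = []
    replayQueue-linked (skip h) = skip (replayQueue-linked h)
    replayQueue-linked (h ∷ hs) = replay-linked h ∷ replayQueue-linked hs

    -- If `u` wins, then `replay` meets the two trees in reverse order. The outcome of a match is
    -- independent of this order only when the roots differ.
    replay-join : (t u : Tree K k) → root (replay g t) ≢ root (replay g u) →
      replay g (join t u) ≡ join (replay g t) (replay g u)
    replay-join t@(node x ts) u@(node y us) ≢ with x ≺? y
    ... | yes _ = sym (join-comm (replay g t) (replay g u) ≢)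
    ... | no  _ = refl

    module _ (g-involutive : ∀ x → g (g x) ≡ x) where

      replay-involutive : {t : Tree K k} → HeapOrdered t → replay g (replay g t) ≡ t
      replayChildren-involutive : ∀ {x} {ts : Children K k} → HeapOrderedBelow x ts →
        replay g (replayChildren g x ts) ≡ node x ts
      replay-involutive (node h) = replayChildren-involutive h
      replayChildren-involutive {x = x} [] = cong (λ y → node y []) (g-involutive x)
      replayChildren-involutive {x = x} (_▹_ {ts = ts} {t} hs (t≺x , h)) = begin
        replay g (join (replayChildren g x ts) (replay g t))
          ≡⟨ replay-join (replayChildren g x ts) (replay g t) roots≢ ⟩
        join (replay g (replayChildren g x ts)) (replay g (replay g t))
          ≡⟨ cong₂ join (replayChildren-involutive hs) (replay-involutive h) ⟩
        join (node x ts) t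
          ≡⟨ join-left (node x ts) t (asym t≺x) ⟩
        node x (ts ▹ t)                                                  ∎
        where
        open ≡-Reasoning
        roots≢ : root (replay g (replayChildren g x ts)) ≢ root (replay g (replay g t))
        roots≢ rewrite replayChildren-involutive hs | replay-involutive h = λ x≡t → irrefl (sym x≡t) t≺x

      replayQueue-involutive : {q : RootList K s} → AllHeapOrdered q → replayQueue g (replayQueue g q) ≡ q
      replayQueue-involutive []       = refl
      replayQueue-involutive (skip h) = cong skip (replayQueue-involutive h)
      replayQueue-involutive (h ∷ hs) = cong₂ _∷_ (replay-involutive h) (replayQueue-involutive hs)

      replay-ordered : {t : Tree K k} → HeapOrdered t → Unique (treeKeys t) → HeapOrdered (replay g t)
      replayChildren-ordered : ∀ {x} {ts : Children K k} → HeapOrderedBelow x ts → Unique (x ∷ childKeys ts) →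
        HeapOrdered (replayChildren g x ts)
      replay-ordered (node h) = replayChildren-ordered h
      replayChildren-ordered [] _ = node []
      replayChildren-ordered {x = x} (_▹_ {ts = ts} {t} hs (t≺x , h)) keys! =
        join-ordered (replayChildren-ordered hs (Unique-++⁻ˡ (x ∷ childKeys ts) keys!))
                     (replay-ordered h (Unique-++⁻ʳ (x ∷ childKeys ts) keys!))
                     roots≢
        where
        roots≢ : root (replayChildren g x ts) ≢ root (replay g t)
        -- The roots are images under `g` of keys from two disjoint parts of the tree, and an
        -- involution is injective.
        roots≢ eq
          with z , z∈ , eq₁ ← ∈-map⁻ g (↭.∈-resp-↭ (linked-keys (replayChildren-linked hs)) (root∈treeKeys (replayChildren g x ts)))
          with w , w∈ , eq₂ ← ∈-map⁻ g (↭.∈-resp-↭ (linked-keys (replay-linked h)) (root∈treeKeys (replay g t)))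
          = Unique-++⇒≢ (x ∷ childKeys ts) keys! z∈ w∈
              (trans (sym (g-involutive z)) (trans (cong g (trans (sym eq₁) (trans eq eq₂))) (g-involutive w)))

      replayQueue-ordered : {q : RootList K s} → AllHeapOrdered q → Unique (queueKeys q) →
        AllHeapOrdered (replayQueue g q)
      replayQueue-ordered []       _     = []
      replayQueue-ordered (skip h) keys! = skip (replayQueue-ordered h keys!)
      replayQueue-ordered (_∷_ {t = t} h hs) keys! =
        replay-ordered h (Unique-++⁻ˡ (treeKeys t) keys!) ∷ replayQueue-ordered hs (Unique-++⁻ʳ (treeKeys t) keys!)

  -- Comparisons made by a single search

  countWithin-++ : ∀ X ps qs → countWithin X (ps ++ qs) ≡ countWithin X ps + countWithin X qs
  countWithin-++ X ps qs = trans (cong length (filter-++ _ ps qs)) (length-++ (filter _ ps))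

  scan-≤-hits : ∀ X m xs → countWithin X (proj₂ (scan m xs)) ≤ hits X xs
  scan-≤-hits X m []       = z≤n
  scan-≤-hits X m (x ∷ xs) with m ≺? x | m ∈? X | x ∈? X
  ... | yes _ | yes _ | yes _ = s≤s (scan-≤-hits X x xs)
  ... | yes _ | yes _ | no _  = scan-≤-hits X x xs
  ... | yes _ | no _  | yes _ = ℕ.m≤n⇒m≤1+n (scan-≤-hits X x xs)
  ... | yes _ | no _  | no _  = scan-≤-hits X x xs
  ... | no _  | yes _ | yes _ = s≤s (scan-≤-hits X m xs)
  ... | no _  | yes _ | no _  = scan-≤-hits X m xs
  ... | no _  | no _  | yes _ = ℕ.m≤n⇒m≤1+n (scan-≤-hits X m xs)
  ... | no _  | no _  | no _  = scan-≤-hits X m xs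

  scan-∉ : ∀ X m xs → m ∉ X → countWithin X (proj₂ (scan m xs)) ≤ hits X xs ∸ 1
  scan-∉ X m []       m∉ = z≤n
  scan-∉ X m (x ∷ xs) m∉ with m ≺? x | m ∈? X | x ∈? X
  ... | _     | yes m∈ | _      = contradiction m∈ m∉
  ... | yes _ | no _   | yes _  = scan-≤-hits X x xs
  ... | no _  | no _   | yes _  = scan-≤-hits X m xs
  ... | yes _ | no _   | no x∉X = scan-∉ X x xs x∉X
  ... | no _  | no _   | no _   = scan-∉ X m xs m∉

  -- The first root in X is not compared with an earlier key of X.
  deleteMax-comparisons : ∀ X (q : Queue K) →
    countWithin X (proj₂ (deleteMax q)) ≤ hits X (rootKeys q) ∸ 1
  deleteMax-comparisons X q with rootKeys q
  ... | []     = z≤n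
  ... | x ∷ xs with x ∈? X
  ...   | yes _  = scan-≤-hits X x xs
  ...   | no x∉X = scan-∉ X x xs x∉X

  roots-≤-small : ∀ X k (q : RootList K s) → hits X (rootKeys q) ≤ k + hits X (small k q)
  roots-≤-small X k []       = z≤n
  roots-≤-small X k (skip q) = roots-≤-small X k q
  roots-≤-small X k (node x ts ∷ q) with k ℕ.≤? length (rootKeys q)
  ... | no k≰ = begin
    hits X (x ∷ rootKeys q)  ≤⟨ length-filter (_∈? X) (x ∷ rootKeys q) ⟩
    suc (length (rootKeys q)) ≤⟨ ℕ.≰⇒> k≰ ⟩
    k                        ≤⟨ ℕ.m≤m+n k _ ⟩
    k + 0                    ∎
    where open ℕ.≤-Reasoning
  ... | yes _ = begin
    hits X (x ∷ rootKeys q)                                   ≡⟨ hits-++ X [ x ] (rootKeys q) ⟩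
    hits X [ x ] + hits X (rootKeys q)
      ≤⟨ ℕ.+-mono-≤ (ℕ.m≤m+n (hits X [ x ]) (hits X (childKeys ts))) (roots-≤-small X k q) ⟩
    hits X [ x ] + hits X (childKeys ts) + (k + hits X (small k q))
      ≡⟨ cong (_+ (k + hits X (small k q))) (hits-++ X [ x ] (childKeys ts)) ⟨
    hits X (x ∷ childKeys ts) + (k + hits X (small k q))
      ≡⟨ x∙yz≈y∙xz (hits X (x ∷ childKeys ts)) k (hits X (small k q)) ⟩
    k + (hits X (x ∷ childKeys ts) + hits X (small k q))
      ≡⟨ cong (k +_) (hits-++ X (x ∷ childKeys ts) (small k q)) ⟨
    k + hits X (x ∷ childKeys ts ++ small k q)                ∎
    where
    open ℕ.≤-Reasoning
    open CommutativeSemigroupProperties ℕ.+-commutativeSemigroup using (x∙yz≈y∙xz)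

  small-0 : (q : RootList K s) → small 0 q ≡ queueKeys q
  small-0 []       = refl
  small-0 (skip q) = small-0 q
  small-0 (t ∷ q)  = cong (treeKeys t ++_) (small-0 q)

  -- The least member has all the others above it, and by definition fewer than `r` keys lie above
  -- it. The case distinction supplies a non-empty list from which to take that member.
  length-largest : ∀ {keys} r → Unique keys → 1 ≤ r → length (largest r keys) ≤ r
  length-largest {keys} r keys! 1≤r with length (largest r keys) ℕ.≤? r
  ... | yes ≤r = ≤r
  ... | no  ≰r with extremum {R = _≺_} ≺-trans total (Unique.filter⁺ _ keys!) (ℕ.≤-trans 1≤r (ℕ.<⇒≤ (ℕ.≰⇒> ≰r)))
    where
    total : ∀ x y → x ≢ y → x ≺ y ⊎ y ≺ x
    total x y x≢y with compare x y
    ... | tri< x≺y _ _ = inj₁ x≺y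
    ... | tri≈ _ x≡y _ = contradiction x≡y x≢y
    ... | tri> _ _ y≺x = inj₂ y≺x
  ... | m , ys , σ , m≺ys = begin
    length (largest r keys)            ≡⟨ ↭.↭-length σ ⟩
    suc (length ys)                    ≤⟨ s≤s (length-⊆ ys! ys⊆) ⟩
    suc (length (filter (m ≺?_) keys)) ≤⟨ proj₂ (∈-filter⁻ _ {xs = keys} (↭.∈-resp-↭ (↭-sym σ) (here refl))) ⟩
    r                                  ∎
    where
    open ℕ.≤-Reasoning
    ys! : Unique ys
    ys! = Unique-++⁻ʳ [ m ] (Unique-resp-↭ σ (Unique.filter⁺ _ keys!))
    ys⊆ : ∀ {y} → y ∈ ys → y ∈ filter (m ≺?_) keys
    ys⊆ y∈ = ∈-filter⁺ (m ≺?_) (proj₁ (∈-filter⁻ _ {xs = keys} (↭.∈-resp-↭ (↭-sym σ) (there y∈)))) (All.lookup m≺ys y∈)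

  -- Exchangeability of the remaining keys

  module _ {keys : List K} (keys! : Unique keys) where

    private
      C = configurations keys

    configurations-unique : Unique C
    configurations-unique = Unique.filter⁺ allHeapOrdered? (placements-unique keys!)

    configurations⁻ : ∀ {q} → q ∈ C → digits q ≡ digitsOf keys × queueKeys q ↭ keys × AllHeapOrdered q
    configurations⁻ q∈ with q∈placements , ordered ← ∈-filter⁻ allHeapOrdered? {xs = placements keys} q∈
      with eq , σ ← placements-sound {keys = keys} q∈placements = eq , σ , ordered

    module _ {x y : K} (x∈ : x ∈ keys) (y∈ : y ∈ keys) where

      private
        g = transpose x y

      replay-configuration : ∀ {q} → q ∈ C → replayQueue g q ∈ C
      replay-configuration q∈ with eq , σ , ordered ← configurations⁻ q∈ =
        ∈-filter⁺ allHeapOrdered?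
          (placements-complete {keys = keys} (trans (sym (linkedQueues-digits linked)) eq)
            (↭-trans (linkedQueues-keys linked) (↭-trans (↭.map⁺ g σ)
              (map-involution keys! g (λ z∈ → transpose-preserves (_∈ keys) x∈ y∈ z∈) (λ _ → transpose-involutive x y _)))))
          (replayQueue-ordered g (transpose-involutive x y) ordered (Unique-resp-↭ (↭-sym σ) keys!))
        where linked = replayQueue-linked g ordered

      replay-∑ : ∀ h → ∑ C (h ∘ replayQueue g) ≡ ∑ C h
      replay-∑ = ∑-involution configurations-unique (replayQueue g) replay-configuration
        (λ q∈ → replayQueue-involutive g (transpose-involutive x y) (proj₂ (proj₂ (configurations⁻ q∈))))

    -- The random queue E q stores the keys S, and exchanging two of them
    -- in q amounts to exchanging them in E q.
    record Exchangeable (S : List K) (E : Queue K → Queue K) : Set (a ⊔ ℓ) where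
      field
        S⊆keys   : ∀ {x} → x ∈ S → x ∈ keys
        contents : ∀ {q} → q ∈ C → queueKeys (E q) ↭ S
        linked   : ∀ {x y} → x ∈ S → y ∈ S → ∀ {q} → q ∈ C →
                   LinkedQueues (transpose x y) (E q) (E (replayQueue (transpose x y) q))

    open Exchangeable

    exchangeable-id : Exchangeable keys id
    exchangeable-id .S⊆keys = id
    exchangeable-id .contents q∈ = proj₁ (proj₂ (configurations⁻ q∈))
    exchangeable-id .linked _ _ q∈ = replayQueue-linked _ (proj₂ (proj₂ (configurations⁻ q∈)))

    exchangeable-↭ : ∀ {S T E} → S ↭ T → Exchangeable S E → Exchangeable T E
    exchangeable-↭ σ ex .S⊆keys       = ex .S⊆keys ∘ ↭.∈-resp-↭ (↭-sym σ)
    exchangeable-↭ σ ex .contents q∈   = ↭-trans (ex .contents q∈) σ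
    exchangeable-↭ σ ex .linked x∈ y∈ = ex .linked (↭.∈-resp-↭ (↭-sym σ) x∈) (↭.∈-resp-↭ (↭-sym σ) y∈)

    -- Exchanging two keys of `S`, both below `m`, leaves `m` fixed and keeps all keys below `m`
    -- below it, as `deleteMax-linked` requires.
    exchangeable-deleteMax : ∀ {m S E} → All (_≺ m) S → Exchangeable (m ∷ S) E →
      Exchangeable S (proj₁ ∘ deleteMax ∘ E)
    exchangeable-deleteMax {m} {S} {E} S≺m ex = record
      { S⊆keys   = ex .S⊆keys ∘ there
      ; contents = λ {q} q∈ → ↭.drop-∷ (↭-trans (deleteMax-keys (E q) (bounded q∈) (m-root q∈)) (ex .contents q∈))
      ; linked   = λ x∈ y∈ {q} q∈ →
          let x≺m = All.lookup S≺m x∈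
              y≺m = All.lookup S≺m y∈
              q′∈ = replay-configuration (ex .S⊆keys (there x∈)) (ex .S⊆keys (there y∈)) q∈
          in  deleteMax-linked
                (transpose-other _ _ (λ m≡x → irrefl (sym m≡x) x≺m) (λ m≡y → irrefl (sym m≡y) y≺m))
                (transpose-preserves (_≺ m) x≺m y≺m)
                (ex .linked (there x∈) (there y∈) q∈) (bounded q∈) (bounded q′∈) (stored q∈)
      }
      where
      bounded : ∀ {q} → q ∈ C → All (λ x → x ≺ m ⊎ x ≡ m) (queueKeys (E q))
      bounded q∈ = ↭.All-resp-↭ (↭-sym (ex .contents q∈)) (inj₂ refl ∷ All.map inj₁ S≺m)
      stored : ∀ {q} → q ∈ C → m ∈ queueKeys (E q)
      stored q∈ = ↭.∈-resp-↭ (↭-sym (ex .contents q∈)) (here refl)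
      m-root : ∀ {q} → q ∈ C → m ∈ rootKeys (E q)
      -- Exchanging `m` with itself changes no key. The link for this transposition shows that each
      -- tree of `E q` is the outcome of a tournament, which puts its maximum at the root.
      m-root q∈ = proj₁ (max-root (transpose-left m m)
        (λ x≺m → subst (_≺ m) (sym (transpose-other m m (x≢m x≺m) (x≢m x≺m))) x≺m)
        (ex .linked (here refl) (here refl) q∈) (bounded q∈) (stored q∈))
        where
        x≢m : ∀ {x} → x ≺ m → x ≢ m
        x≢m x≺m x≡m = irrefl x≡m x≺m

    -- A key `x` occurs among the small trees of `E q` as often as `y` does after replaying `q` with
    -- `x` and `y` exchanged. Replaying permutes the configurations, so `x` and `y` have equal
    -- totals.
    exchangeable-small : ∀ {S E X} k → Unique S → Unique X → 1 ≤ length S → Exchangeable S E →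
      2 ^ k * ∑ C (λ q → hits X (small k (E q))) ≤ length X * length C
    exchangeable-small {S} {E} k S! X! 1≤S ex =
      equidistributed C (small k ∘ E) (2 ^ k) S! X! 1≤S
        (λ {q} q∈ x∈ → ↭.∈-resp-↭ (ex .contents q∈) (small⊆queueKeys k (E q) x∈))
        (λ {q} q∈ → ℕ.≤-trans (length-small k (E q)) (ℕ.≤-reflexive (↭.↭-length (ex .contents q∈))))
        symmetric
      where
      symmetric : ∀ {x y} → x ∈ S → y ∈ S →
        ∑ C (λ q → occurrences x (small k (E q))) ≡ ∑ C (λ q → occurrences y (small k (E q)))
      symmetric {x} {y} x∈ y∈ = begin
        ∑ C (λ q → occurrences x (small k (E q)))               ≡⟨ ∑-cong C (λ {q} q∈ → sym (begin
          occurrences y (small k (E (replayQueue g q)))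
            ≡⟨ cong (λ z → occurrences z (small k (E (replayQueue g q)))) (transpose-left x y) ⟨
          occurrences (g x) (small k (E (replayQueue g q)))
            ≡⟨ occurrences-↭ (g x) (linkedQueues-small k (ex .linked x∈ y∈ q∈)) ⟩
          occurrences (g x) (map g (small k (E q)))
            ≡⟨ occurrences-map g g-injective x (small k (E q)) ⟩
          occurrences x (small k (E q))                         ∎)) ⟩
        ∑ C (λ q → occurrences y (small k (E (replayQueue g q))))
          ≡⟨ replay-∑ (ex .S⊆keys x∈) (ex .S⊆keys y∈) (λ q → occurrences y (small k (E q))) ⟩
        ∑ C (λ q → occurrences y (small k (E q)))               ∎
        where
        open ≡-Reasoning
        g = transpose x y
        g-injective : ∀ {z w} → g z ≡ g w → z ≡ w
        g-injective {z} {w} eq = trans (sym (transpose-involutive x y z)) (trans (cong g eq) (transpose-involutive x y w))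

    -- Summation over the deletions

    module _ {X : List K} (X! : Unique X) (r : ℕ) (X≤r : length X ≤ r) (1≤r : 1 ≤ r) where

      private
        c = length C

      -- The mean `k + r / 2ᵏ - 1` of the overview with denominators cleared; the -1 stands on the
      -- left as `2 ^ k * c`.
      step-bound : ∀ k {S E} → Unique S → 1 ≤ length S → Exchangeable S E →
        2 ^ k * ∑ C (λ q → countWithin X (proj₂ (deleteMax (E q)))) + 2 ^ k * c ≤ c * (k * 2 ^ k + r)
      -- For `k = 0` the subtraction in `h ∸ 1` may be truncated, so it cannot be pulled out of the
      -- sum. A bound for each configuration replaces the average: at most `r` roots lie in `X`.
      step-bound zero {S} {E} S! 1≤S ex = begin
        1 * ∑ C w + 1 * c       ≡⟨ cong₂ _+_ (ℕ.*-identityˡ (∑ C w)) (ℕ.*-identityˡ c) ⟩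
        ∑ C w + c               ≤⟨ ℕ.+-monoˡ-≤ c (∑-mono C λ q∈ → w≤ q∈) ⟩
        ∑ C (λ _ → r ∸ 1) + c   ≡⟨ cong (_+ c) (∑-const C (r ∸ 1)) ⟩
        c * (r ∸ 1) + c         ≡⟨ ℕ.+-comm (c * (r ∸ 1)) c ⟩
        c + c * (r ∸ 1)         ≡⟨ ℕ.*-suc c (r ∸ 1) ⟨
        c * suc (r ∸ 1)         ≡⟨ cong (c *_) (ℕ.m+[n∸m]≡n 1≤r) ⟩
        c * r                   ∎
        where
        open ℕ.≤-Reasoning
        w : Queue K → ℕ
        w q = countWithin X (proj₂ (deleteMax (E q)))
        w≤ : ∀ {q} → q ∈ C → w q ≤ r ∸ 1
        w≤ {q} q∈ = begin
          w q                           ≤⟨ deleteMax-comparisons X (E q) ⟩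
          hits X (rootKeys (E q)) ∸ 1   ≤⟨ ℕ.∸-monoˡ-≤ 1 (roots-≤-small X 0 (E q)) ⟩
          hits X (small 0 (E q)) ∸ 1    ≡⟨ cong (λ xs → hits X xs ∸ 1) (small-0 (E q)) ⟩
          hits X (queueKeys (E q)) ∸ 1
            ≤⟨ ℕ.∸-monoˡ-≤ 1 (ℕ.≤-trans (hits-≤ X (Unique-resp-↭ (↭-sym (ex .contents q∈)) S!)) X≤r) ⟩
          r ∸ 1                         ∎
      step-bound (suc k) {S} {E} S! 1≤S ex = begin
        N * ∑ C w + N * c
          ≤⟨ ℕ.+-monoˡ-≤ (N * c) (ℕ.*-monoʳ-≤ N (∑-mono C λ {q} _ → w≤ q)) ⟩
        N * ∑ C (λ q → k + h q) + N * c
          ≡⟨ cong (λ z → N * z + N * c) (trans (∑-+ C (λ _ → k) h) (cong (_+ ∑ C h) (∑-const C k))) ⟩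
        N * (c * k + ∑ C h) + N * c
          ≡⟨ solve 4 (λ N c k h → N :* (c :* k :+ h) :+ N :* c := c :* (N :+ k :* N) :+ N :* h) refl N c k (∑ C h) ⟩
        c * (N + k * N) + N * ∑ C h
          ≤⟨ ℕ.+-monoʳ-≤ (c * (N + k * N)) (exchangeable-small (suc k) S! X! 1≤S ex) ⟩
        c * (N + k * N) + length X * c
          ≤⟨ ℕ.+-monoʳ-≤ (c * (N + k * N)) (ℕ.*-monoˡ-≤ c X≤r) ⟩
        c * (N + k * N) + r * c                          ≡⟨ cong (c * (N + k * N) +_) (ℕ.*-comm r c) ⟩
        c * (N + k * N) + c * r                          ≡⟨ ℕ.*-distribˡ-+ c (N + k * N) r ⟨
        c * (N + k * N + r)                              ∎
        where
        open ℕ.≤-Reasoning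
        open +-*-Solver
        N = 2 ^ suc k
        w h : Queue K → ℕ
        w q = countWithin X (proj₂ (deleteMax (E q)))
        h q = hits X (small (suc k) (E q))
        w≤ : ∀ q → w q ≤ k + h q
        -- `suc k + h q ∸ 1` reduces to `k + h q`, so here nothing is truncated.
        w≤ q = ℕ.≤-trans (deleteMax-comparisons X (E q)) (ℕ.∸-monoˡ-≤ 1 (roots-≤-small X (suc k) (E q)))

      -- The stored set `S` is the same for every configuration at each stage, and so is its maximum
      -- `m`. Removing `m` leaves an exchangeable queue on `T`, while `X` and `k` stay fixed, so
      -- `step-bound` applies at every deletion.
      search-bound : ∀ k i {S E} → Unique S → i ≤ length S → Exchangeable S E →
        2 ^ k * ∑ C (λ q → countWithin X (searchComparisons i (E q))) + i * (2 ^ k * c) ≤ i * (c * (k * 2 ^ k + r))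
      search-bound k zero {S} {E} _ _ _ = ℕ.≤-reflexive (begin
        2 ^ k * ∑ C (λ _ → 0) + 0  ≡⟨ ℕ.+-identityʳ _ ⟩
        2 ^ k * ∑ C (λ _ → 0)      ≡⟨ cong (2 ^ k *_) (trans (∑-const C 0) (ℕ.*-zeroʳ c)) ⟩
        2 ^ k * 0                  ≡⟨ ℕ.*-zeroʳ (2 ^ k) ⟩
        0                          ∎)
        where open ≡-Reasoning
      search-bound k (suc i) {S} {E} S! i<S ex
        with extremum {R = flip _≺_} (λ y≺x z≺y → ≺-trans z≺y y≺x) total S! (ℕ.≤-trans (s≤s z≤n) i<S)
        where
        total : ∀ x y → x ≢ y → y ≺ x ⊎ x ≺ y
        total x y x≢y with compare x y
        ... | tri< x≺y _ _ = inj₂ x≺y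
        ... | tri≈ _ x≡y _ = contradiction x≡y x≢y
        ... | tri> _ _ y≺x = inj₁ y≺x
      ... | m , T , σ , T≺m = begin
        N * ∑ C (λ q → countWithin X (searchComparisons (suc i) (E q))) + (N * c + i * (N * c))
          ≡⟨ cong (λ z → N * z + (N * c + i * (N * c))) (trans (∑-cong C λ {q} _ → countWithin-++ X (proj₂ (deleteMax (E q))) _) (∑-+ C w v)) ⟩
        N * (∑ C w + ∑ C v) + (N * c + i * (N * c))
          ≡⟨ solve 5 (λ N w v c d → N :* (w :+ v) :+ (c :+ d) := (N :* w :+ c) :+ (N :* v :+ d)) refl N (∑ C w) (∑ C v) (N * c) (i * (N * c)) ⟩
        (N * ∑ C w + N * c) + (N * ∑ C v + i * (N * c))
          ≤⟨ ℕ.+-mono-≤ (step-bound k S! (ℕ.≤-trans (s≤s z≤n) i<S) ex)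
                        (search-bound k i T! i≤T (exchangeable-deleteMax T≺m (exchangeable-↭ σ ex))) ⟩
        c * (k * N + r) + i * (c * (k * N + r)) ∎
        where
        open ℕ.≤-Reasoning
        open +-*-Solver
        N = 2 ^ k
        w v : Queue K → ℕ
        w q = countWithin X (proj₂ (deleteMax (E q)))
        v q = countWithin X (searchComparisons i (proj₁ (deleteMax (E q))))
        T! : Unique T
        T! = Unique-++⁻ʳ [ m ] (Unique-resp-↭ σ S!)
        i≤T : i ≤ length T
        i≤T = ℕ.≤-pred (ℕ.≤-trans i<S (ℕ.≤-reflexive (↭.↭-length σ)))

-- From counts to the expectation

expectation-≤ : ∀ {A : Set a} (xs : List A) f r q → 0ℚ ℚ.< q →
  ∑ xs f * ↧ₙ q ≤ r * ℤ.∣ ↥ q ∣ * length xs → expectation xs f ℚ.≤ fromℕℚ r ℚ.* q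
-- The dummy value `0ℚ` is read as the fraction 0 / 1.
expectation-≤ []         f r q 0<q _ = /-≤-* 0 1 r q 0<q z≤n
expectation-≤ xs@(_ ∷ _) f r q 0<q ≤ = /-≤-* (∑ xs f) (length xs) r q 0<q ≤

theorem2 : {a ℓ : Level} {K : Set a} {_≺_ : Rel K ℓ}
    (isSTO : IsStrictTotalOrder _≡_ _≺_) →
    let open BinomialHeap isSTO in
    (n : ℕ) (keys : List K) → length keys ≡ n → Unique keys →
    (r : ℕ) → 1 ≤ r → r ≤ n →
    expectedSearchComparisons r keys
    ≤ℝ fromℕ 2 · ln 2 · fromℕ r · log₂ r
theorem2 isSTO n keys refl keys! r 1≤r r≤n =
  rlog₂r≤2ln2rlog₂r (expectedSearchComparisons r keys) r bound
  where
  open BinomialHeap isSTO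
  C = configurations keys
  X! : Unique (largest r keys)
  X! = Unique.filter⁺ _ keys!
  total = ∑ C (λ q → countWithin (largest r keys) (searchComparisons r q))
  bound : ∀ q → log₂ r q → expectedSearchComparisons r keys ℚ.≤ fromℕℚ r ℚ.* q
  bound q (0<q , rᵛ<2ᵘ) with k , b , b≤N , refl ← floor-log₂ r 1≤r =
    expectation-≤ C _ r q 0<q (ℕ.*-cancelˡ-≤ N {{ℕ.>-nonZero (ℕ.m^n>0 2 k)}} (begin
      N * (total * v)               ≡⟨ ℕ.*-assoc N total v ⟨
      N * total * v                 ≤⟨ ℕ.*-monoˡ-≤ v Ntotal≤ ⟩
      r * (c * (k * N + b)) * v
        ≡⟨ solve 4 (λ r c l v → r :* (c :* l) :* v := r :* c :* (v :* l)) refl r c (k * N + b) v ⟩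
      r * c * (v * (k * N + b))     ≤⟨ ℕ.*-monoʳ-≤ (r * c) (log₂-interpolation k b u v b≤N rᵛ<2ᵘ) ⟩
      r * c * (u * N)
        ≡⟨ solve 4 (λ r c u N → r :* c :* (u :* N) := N :* (r :* u :* c)) refl r c u N ⟩
      N * (r * u * c)               ∎))
    where
    open ℕ.≤-Reasoning
    open +-*-Solver
    N = 2 ^ k
    u = ℤ.∣ ↥ q ∣
    v = ↧ₙ q
    c = length C
    Ntotal≤ : N * total ≤ r * (c * (k * N + b))
    -- As `r` is `N + b`, the bound for each search contains `N * c`, equal to the term for the -1
    -- on the left. Cancelling both leaves `k * N + b`, the interpolated logarithm times `N`.
    Ntotal≤ = ℕ.+-cancelʳ-≤ (r * (N * c)) _ _ (begin
      N * total + r * (N * c)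
        ≤⟨ search-bound isSTO keys! X! r (length-largest isSTO r keys! 1≤r) 1≤r k r keys! r≤n (exchangeable-id isSTO keys!) ⟩
      r * (c * (k * N + (N + b)))
        ≡⟨ solve 5 (λ r c k N b → r :* (c :* (k :* N :+ (N :+ b))) := r :* (c :* (k :* N :+ b)) :+ r :* (N :* c)) refl r c k N b ⟩
      r * (c * (k * N + b)) + r * (N * c)      ∎)
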